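{- Let $q\ge 1$ be an integer and consider an open necklace of $n$ beads arranged in a line, each bead having a color in $[m]$; let $a_j$ be the number of beads of color $j$ and $r_j$ the remainder of the Euclidean division of $a_j$ by $q$. Suppose $r_j\in\{0,1,q-1\}$ for all $j\in[m]$. Then for every choice, for each $j$ with $r_j\neq 0$, of a set $A_j\subseteq[q]$ of exactly $r_j$ thieves, there exists a fair $q$-splitting of the necklace using at most $(q-1)m$ cuts in which, for each $j$ with $r_j\ne0$, every thief $t\in A_j$ receives $\lceil a_j/q\rceil$ beads of color $j$ and every thief $t\notin A_j$ receives $\lfloor a_j/q\rfloor$ beads of color $j$.
   Context: A $q$-splitting of the necklace with $c$ cuts is obtained by cutting the line of beads at $c$ positions between consecutive beads, producing $c+1$ intervals, and assigning each interval to one of $q$ thieves (identified with $[q]$); each thief receives the beads of the intervals assigned to it. It is fair if for every color $j$ each thief receives $\lfloor a_j/q\rfloor$ or $\lceil a_j/q\rceil$ beads of color $j$. -}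

module Defs where

open import Data.Nat using (ℕ; zero; suc; _+_; _∸_; _<_; _≤_; NonZero)
open import Data.Nat.DivMod using (_/_)
open import Data.Fin using (Fin; zero; suc; toℕ; inject₁)
open import Data.Bool using (Bool; true; false; if_then_else_; _∧_)
open import Data.Product using (_×_)
open import Data.Sum using (_⊎_)
open import Relation.Binary.PropositionalEquality using (_≡_)
open import Relation.Nullary.Decidable using (⌊_⌋)
open import Data.Fin.Properties using () renaming (_≟_ to _≟ᶠ_)
open import Data.Nat.Properties using () renaming (_≤?_ to _≤?ℕ_)

countF : (k : ℕ) → (Fin k → Bool) → ℕ
countF zero    f = 0
countF (suc k) f = (if f zero then 1 else 0) + countF k (λ i → f (suc i))

countFin : (k : ℕ) → (Fin k → Bool) → Fin (suc k)
countFin zero    f = zero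
countFin (suc k) f =
  if f zero then suc (countFin k (λ i → f (suc i)))
            else inject₁ (countFin k (λ i → f (suc i)))

⌈_/_⌉ : (a q : ℕ) → .{{NonZero q}} → ℕ
⌈ a / q ⌉ = (a + (q ∸ 1)) / q

colourCount : {n m : ℕ} → (Fin n → Fin m) → Fin m → ℕ
colourCount {n} col j = countF n (λ i → ⌊ col i ≟ᶠ j ⌋)

-- A q-splitting with c cuts: c cut positions p (a cut at p lies between
-- bead p-1 and bead p, 0-based), so 0 < p < n, strictly increasing,
-- yielding c+1 intervals numbered 0..c, each assigned to a thief in Fin q.
record Splitting (n q : ℕ) : Set where
  field
    c       : ℕ
    cut     : Fin c → ℕ
    cut-pos : ∀ k → 0 < cut k × cut k < n
    cut-inc : ∀ (k l : Fin c) → toℕ k < toℕ l → cut k < cut l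
    assign  : Fin (suc c) → Fin q
  interval : Fin n → Fin (suc c)
  interval i = countFin c (λ k → ⌊ cut k ≤?ℕ toℕ i ⌋)
  thief : Fin n → Fin q
  thief i = assign (interval i)

received : {n m q : ℕ} → (Fin n → Fin m) → Splitting n q → Fin q → Fin m → ℕ
received {n} col s t j =
  countF n (λ i → ⌊ col i ≟ᶠ j ⌋ ∧ ⌊ Splitting.thief s i ≟ᶠ t ⌋)

Fair : {n m q : ℕ} .{{_ : NonZero q}} → (Fin n → Fin m) → Splitting n q → Set
Fair {q = q} col s = ∀ t j →
  (received col s t j ≡ colourCount col j / q) ⊎ (received col s t j ≡ ⌈ colourCount col j / q ⌉)

-- For a prime number p of thieves, a word over ℤ/p records who gets which bead. Label a finite set of words by the pairs
-- (colour, thief) of largest excess occurring in it. Were no column {j} × ℤ/p ever full, the label sets met along a chain of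
-- N + 1 nested clusters (N = (p − 1) m) of nearby words with at most N cuts would have size at most N, so two consecutive
-- ones would coincide. But an equivariant homological argument in the style of Dold's theorem produces a chain along which
-- the mean thief of the first nonempty column always changes. A full column yields a splitting that is fair up to an error
-- independent of the length of the necklace. Such almost fair splittings compose multiplicatively in the number of
-- thieves. Finally each bead is replaced by many copies, making the error negligible, and Hall's theorem rounds the copies
-- of a bead to one of the thieves that own some of them; the hypothesis on the remainders is what makes the prescribed
-- quotas satisfy Hall's condition.
module Submission where

open import Defs
import Data.Nat as ℕ
open import Data.Nat using (ℕ; zero; suc; _∸_; _≤_; _<_; s≤s; z≤n; NonZero)
import Data.Nat.Properties as ℕ
import Data.Nat.Divisibility as ℕ
open import Data.Nat.DivMod using (_/_; _%_; _mod_; m≡m%n+[m/n]*n; m%n<n; n%n≡0; m<n⇒m%n≡m;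
  [m+n]%n≡m%n; [m+kn]%n≡m%n; %-distribˡ-+; %-distribˡ-*;
  +-distrib-/-∣ʳ; m<n⇒m/n≡0; m*n/n≡m)
open import Data.Nat.GeneralisedArithmetic using (fold)
import Data.Integer as ℤ
open import Data.Integer using (ℤ)
import Data.Integer.Properties as ℤ
open import Data.Fin using (Fin; zero; suc; toℕ; _≟_; combine)
import Data.Fin.Properties as Fin
open import Data.Bool using (Bool; true; false; not; _∧_; if_then_else_)
open import Data.Bool.Properties using (∧-comm; ∧-assoc)
import Data.Empty as Empty
open import Data.List as List using (List; []; _∷_; length)
import Data.List.Properties as List
import Data.List.Relation.Binary.Subset.Propositional.Properties as Subset
open import Data.List.Relation.Unary.All as All using (All; []; _∷_)
import Data.List.Relation.Unary.All.Properties as All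
open import Data.List.Relation.Unary.Linked as Linked using (Linked; []; [-]; _∷_)
import Data.List.Relation.Unary.Linked.Properties as Linked
open import Data.Product using (∃; Σ; _×_; _,_; proj₁; proj₂)
open import Data.Sum using (_⊎_; inj₁; inj₂; [_,_]′)
open import Data.Vec as Vec using (Vec; []; _∷_; here; there; lookup; tabulate; replicate; concat)
import Data.Vec.Properties as Vec
open import Algebra.Properties.CommutativeMonoid.Sum ℕ.+-0-commutativeMonoid
  using (sum; sum-cong-≗; ∑-distrib-+; ∑-comm; sum-permute)
open import Algebra.Properties.Semiring.Sum ℕ.+-*-semiring using (*-distribˡ-sum; *-distribʳ-sum)
open import Function using (_∘_; const; id)
open import Relation.Binary.PropositionalEquality
open import Relation.Nullary using (¬_; yes; no; contradiction; Dec)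
open import Relation.Nullary.Decidable using (⌊_⌋; map′; _×-dec_; ¬?; decidable-stable)

-- Cochains, prisms and the ℤ/p-index

-- No highly connected complex is ever constructed. The cells are chains of clusters, and the bound
-- on cuts and distances inside a cluster grows with the dimension of the cell: sweeping a new cut
-- through a cell raises its dimension, its cuts and its distances by at most one each. A chain of
-- dimension N grown from a constant word therefore involves at most N cuts, and (p - 1) m is at
-- once this dimension and the largest number of labels without a full column; so the count closes
-- with no cut to spare.
--
-- Primality is needed because a proper nonempty subset of ℤ/p then has invertible size, hence a
-- mean that rotates with it. Exact fairness would not survive the passage to composite q, since the
-- remainders inside the parts are uncontrolled. So only one-sided bounds with a bounded error are
-- composed, and rounding takes place once, at the end. It creates no cuts: choosing one owner among
-- the copies of each bead extracts a subsequence.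

module _ where

  open import Data.Integer using (+_; 0ℤ; 1ℤ; _+_; _-_; _*_)
  open import Data.Integer.Divisibility.Signed using (_∣_; divides; ∣m∣n⇒∣m-n; ∣⇒∣ᵤ)
  open import Data.Integer.Tactic.RingSolver using (solve-∀)
  open import Data.List using (map)

  sumN : ℕ → (ℕ → ℤ) → ℤ
  sumN zero    f = 0ℤ
  sumN (suc n) f = sumN n f + f n

  sumN-cong : ∀ n {f g : ℕ → ℤ} → (∀ a → a < n → f a ≡ g a) → sumN n f ≡ sumN n g
  sumN-cong zero    e = refl
  sumN-cong (suc n) e = cong₂ _+_ (sumN-cong n λ a a<n → e a (ℕ.m<n⇒m<1+n a<n)) (e n (ℕ.n<1+n n))

  sumN-zero : ∀ n {f : ℕ → ℤ} → (∀ a → a < n → f a ≡ 0ℤ) → sumN n f ≡ 0ℤ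
  sumN-zero zero    e = refl
  sumN-zero (suc n) e = cong₂ _+_ (sumN-zero n λ a a<n → e a (ℕ.m<n⇒m<1+n a<n)) (e n (ℕ.n<1+n n))

  sumN-telescope : ∀ n (f : ℕ → ℤ) → sumN n (λ a → f (suc a) - f a) ≡ f n - f 0
  sumN-telescope zero    f = sym (ℤ.+-inverseʳ (f 0))
  sumN-telescope (suc n) f = trans (cong (_+ (f (suc n) - f n)) (sumN-telescope n f)) (ring (f n) (f 0) (f (suc n)))
    where
    ring : ∀ a b c → (a - b) + (c - a) ≡ c - b
    ring = solve-∀

  sumN-plus : ∀ n (f g : ℕ → ℤ) → sumN n (λ a → f a + g a) ≡ sumN n f + sumN n g
  sumN-plus zero    f g = refl
  sumN-plus (suc n) f g = trans (cong (_+ (f n + g n)) (sumN-plus n f g)) (ring (sumN n f) (sumN n g) (f n) (g n))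
    where
    ring : ∀ a b c d → (a + b) + (c + d) ≡ (a + c) + (b + d)
    ring = solve-∀

  sumN-minus : ∀ n (f g : ℕ → ℤ) → sumN n (λ a → f a - g a) ≡ sumN n f - sumN n g
  sumN-minus zero    f g = refl
  sumN-minus (suc n) f g = trans (cong (_+ (f n - g n)) (sumN-minus n f g)) (ring (sumN n f) (sumN n g) (f n) (g n))
    where
    ring : ∀ a b c d → (a - b) + (c - d) ≡ (a + c) - (b + d)
    ring = solve-∀

  sumN-const : ∀ n c → sumN n (λ _ → c) ≡ + n * c
  sumN-const zero    c = sym (ℤ.*-zeroˡ c)
  sumN-const (suc n) c = trans (cong (_+ c) (sumN-const n c)) (trans (ℤ.+-comm (+ n * c) c) (sym (ℤ.suc-* (+ n) c)))

  sumN-head : ∀ n {f : ℕ → ℤ} → (∀ a → a < n → f (suc a) ≡ 0ℤ) → sumN (suc n) f ≡ f 0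
  sumN-head zero    {f} e = ℤ.+-identityˡ (f 0)
  sumN-head (suc n) {f} e =
    trans (cong₂ _+_ (sumN-head n λ a a<n → e a (ℕ.m<n⇒m<1+n a<n)) (e n (ℕ.n<1+n n))) (ℤ.+-identityʳ (f 0))

  -- Simplicial cochains on lists

  Cochain : Set → Set
  Cochain X = List X → ℤ

  module _ {X : Set} where

    infixl 6 _⊖_
    _⊖_ : Cochain X → Cochain X → Cochain X
    (φ ⊖ ψ) l = φ l - ψ l

    infixl 5 _▹_
    _▹_ : Cochain X → X → Cochain X
    (φ ▹ x) l = φ (x ∷ l)

    -- Subtraction alone suffices, because a + b = a - (0 - b). The field `cong-≗` takes the place
    -- of function extensionality, so that pointwise identities of cochains can be used under an
    -- operator.
    record Linear (F : Cochain X → ℤ) : Set where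
      field
        cong-≗ : ∀ {φ ψ} → φ ≗ ψ → F φ ≡ F ψ
        minus  : ∀ φ ψ → F (φ ⊖ ψ) ≡ F φ - F ψ

      zero-≗ : ∀ {φ} → (∀ l → φ l ≡ 0ℤ) → F φ ≡ 0ℤ
      zero-≗ {φ} e = trans (cong-≗ {φ} {φ ⊖ φ} λ l → trans (e l) (sym (ℤ.+-inverseʳ (φ l))))
                           (trans (minus φ φ) (ℤ.+-inverseʳ (F φ)))

      plus : ∀ φ ψ → F (λ l → φ l + ψ l) ≡ F φ + F ψ
      plus φ ψ = begin
        F (λ l → φ l + ψ l)  ≡⟨ cong-≗ (λ l → ring (φ l) (ψ l)) ⟩
        F (φ ⊖ (o ⊖ ψ))      ≡⟨ minus φ (o ⊖ ψ) ⟩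
        F φ - F (o ⊖ ψ)      ≡⟨ cong (λ z → F φ - z) (minus o ψ) ⟩
        F φ - (F o - F ψ)    ≡⟨ cong (λ z → F φ - (z - F ψ)) (zero-≗ {o} λ _ → refl) ⟩
        F φ - (0ℤ - F ψ)     ≡⟨ ring (F φ) (F ψ) ⟨
        F φ + F ψ            ∎
        where
        open ≡-Reasoning
        o : Cochain X
        o _ = 0ℤ
        ring : ∀ a b → a + b ≡ a - (0ℤ - b)
        ring = solve-∀

      sums : ∀ n (φ : ℕ → Cochain X) → F (λ l → sumN n λ a → φ a l) ≡ sumN n λ a → F (φ a)
      sums zero    φ = zero-≗ λ _ → refl
      sums (suc n) φ = trans (plus (λ l → sumN n λ a → φ a l) (φ n)) (cong (_+ F (φ n)) (sums n φ))

    data Dup : List X → Set where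
      here  : ∀ {x xs} → Dup (x ∷ x ∷ xs)
      there : ∀ {x xs} → Dup xs → Dup (x ∷ xs)

    -- Normalised cochains, which ignore degenerate cells. They vanish on constant lists of at least
    -- two entries, and this disposes of the far end of the contraction in the index argument.
    Normal : Cochain X → Set
    Normal φ = ∀ {l} → Dup l → φ l ≡ 0ℤ

    Normal-▹ : ∀ {φ} → Normal φ → ∀ x → Normal (φ ▹ x)
    Normal-▹ n x d = n (there d)

    -- The augmented coboundary in all degrees at once: unfolded, the alternating sum over the
    -- deletions of one entry. The value at `[]` is the part of degree -1.
    δ : Cochain X → Cochain X
    δ φ []       = 0ℤ
    δ φ (x ∷ xs) = φ xs - δ (φ ▹ x) xs

    δ-linear : ∀ l → Linear (λ φ → δ φ l)
    δ-linear l = record { cong-≗ = c l ; minus = m l }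
      where
      c : ∀ l {φ ψ} → φ ≗ ψ → δ φ l ≡ δ ψ l
      c []       e = refl
      c (x ∷ xs) e = cong₂ _-_ (e xs) (c xs (λ l → e (x ∷ l)))
      ring : ∀ a b c d → (a - b) - (c - d) ≡ (a - c) - (b - d)
      ring = solve-∀
      m : ∀ l φ ψ → δ (φ ⊖ ψ) l ≡ δ φ l - δ ψ l
      m []       φ ψ = refl
      m (x ∷ xs) φ ψ = trans (cong (λ z → (φ xs - ψ xs) - z) (m xs (φ ▹ x) (ψ ▹ x)))
                             (ring (φ xs) (ψ xs) (δ (φ ▹ x) xs) (δ (ψ ▹ x) xs))

    δ∘δ : ∀ φ l → δ (δ φ) l ≡ 0ℤ
    δ∘δ φ []       = refl
    δ∘δ φ (x ∷ xs) = begin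
      δ φ xs - δ (φ ⊖ δ (φ ▹ x)) xs          ≡⟨ cong (λ z → δ φ xs - z) (Linear.minus (δ-linear xs) φ (δ (φ ▹ x))) ⟩
      δ φ xs - (δ φ xs - δ (δ (φ ▹ x)) xs)   ≡⟨ cong (λ z → δ φ xs - (δ φ xs - z)) (δ∘δ (φ ▹ x) xs) ⟩
      δ φ xs - (δ φ xs - 0ℤ)                 ≡⟨ ring (δ φ xs) ⟩
      0ℤ                                     ∎
      where
      open ≡-Reasoning
      ring : ∀ a → a - (a - 0ℤ) ≡ 0ℤ
      ring = solve-∀

    -- Deleting either of two equal neighbours leaves the same list, with opposite signs; every
    -- other deletion keeps the repetition.
    δ-normal : ∀ {φ} → Normal φ → Normal (δ φ)
    δ-normal {φ} n {x ∷ .x ∷ xs} here = begin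
      φ (x ∷ xs) - (φ (x ∷ xs) - δ (φ ▹ x ▹ x) xs)
        ≡⟨ cong (λ z → φ (x ∷ xs) - (φ (x ∷ xs) - z)) (Linear.zero-≗ (δ-linear xs) λ l → n here) ⟩
      φ (x ∷ xs) - (φ (x ∷ xs) - 0ℤ)
        ≡⟨ ring (φ (x ∷ xs)) ⟩
      0ℤ ∎
      where
      open ≡-Reasoning
      ring : ∀ a → a - (a - 0ℤ) ≡ 0ℤ
      ring = solve-∀
    δ-normal {φ} n {x ∷ xs} (there d) = cong₂ _-_ (n d) (δ-normal (Normal-▹ {φ} n x) d)

  module _ {X Y : Set} (f : X → Y) where

    δ-map : ∀ φ l → δ (φ ∘ map f) l ≡ δ φ (map f l)
    δ-map φ []       = refl
    δ-map φ (x ∷ xs) = cong (λ z → φ (map f xs) - z) (δ-map (φ ▹ f x) xs)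

    Dup-map : ∀ {l} → Dup l → Dup (map f l)
    Dup-map here      = here
    Dup-map (there d) = there (Dup-map d)

  -- Prism operators

  module _ {X : Set} (f g : X → X) where

    -- The sum of (-1)ⁱ φ (f x₀, ..., f xᵢ, g xᵢ, ..., g xₙ).
    prism : Cochain X → Cochain X
    prism φ []       = 0ℤ
    prism φ (x ∷ xs) = φ (f x ∷ g x ∷ map g xs) - prism (φ ▹ f x) xs

    -- The support of the prism sum. Vanishing arguments only need to know which lists occur, not
    -- their signs.
    data PrismCell : List X → List X → Set where
      here  : ∀ {x xs} → PrismCell (x ∷ xs) (f x ∷ g x ∷ map g xs)
      there : ∀ {x xs l} → PrismCell xs l → PrismCell (x ∷ xs) (f x ∷ l)

    prism-vanish : ∀ φ xs → (∀ {l} → PrismCell xs l → φ l ≡ 0ℤ) → prism φ xs ≡ 0ℤ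
    prism-vanish φ []       e = refl
    prism-vanish φ (x ∷ xs) e = cong₂ _-_ (e here) (prism-vanish (φ ▹ f x) xs λ c → e (there c))

    prism-linear : ∀ l → Linear (λ φ → prism φ l)
    prism-linear l = record { cong-≗ = c l ; minus = m l }
      where
      c : ∀ l {φ ψ} → φ ≗ ψ → prism φ l ≡ prism ψ l
      c []       e = refl
      c (x ∷ xs) e = cong₂ _-_ (e _) (c xs (λ l → e (f x ∷ l)))
      ring : ∀ a b c d → (a - b) - (c - d) ≡ (a - c) - (b - d)
      ring = solve-∀
      m : ∀ l φ ψ → prism (φ ⊖ ψ) l ≡ prism φ l - prism ψ l
      m []       φ ψ = refl
      m (x ∷ xs) φ ψ = trans (cong (λ z → (φ l′ - ψ l′) - z) (m xs (φ ▹ f x) (ψ ▹ f x)))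
                             (ring (φ l′) (ψ l′) (prism (φ ▹ f x) xs) (prism (ψ ▹ f x) xs))
        where l′ = f x ∷ g x ∷ map g xs

    prism-normal : ∀ {φ} → Normal φ → Normal (prism φ)
    prism-normal {φ} n {l} d = prism-vanish φ l λ c → n (dup d c)
      where
      dup : ∀ {xs l} → Dup xs → PrismCell xs l → Dup l
      dup here      here              = there here
      dup here      (there here)      = here
      dup here      (there (there c)) = here
      dup (there d) here              = there (there (Dup-map g d))
      dup (there d) (there c)         = there (dup d c)

    prism-homotopy : ∀ φ l → prism (δ φ) l + δ (prism φ) l ≡ φ (map g l) - φ (map f l)
    prism-homotopy φ []       = sym (ℤ.+-inverseʳ (φ []))
    prism-homotopy φ (x ∷ xs) = begin
      prism (δ φ) (x ∷ xs) + δ (prism φ) (x ∷ xs)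
        ≡⟨ cong₂ (λ u v → (B - (C - G) - u) + (Q - v))
             (Linear.minus (prism-linear xs) φ (δ (φ ▹ f x)))
             (trans (Linear.minus (δ-linear xs) (λ l → φ (f x ∷ g x ∷ map g l)) (prism (φ ▹ f x)))
                    (cong (_- δ (prism (φ ▹ f x)) xs) (δ-map g (φ ▹ f x ▹ g x) xs))) ⟩
      (B - (C - G) - (Q - R)) + (Q - (G - S))
        ≡⟨ ring₁ B C G Q R S ⟩
      B - C + (R + S)
        ≡⟨ cong (λ z → B - C + z) (prism-homotopy (φ ▹ f x) xs) ⟩
      B - C + (C - E)
        ≡⟨ ring₂ B C E ⟩
      B - E ∎
      where
      open ≡-Reasoning
      B = φ (g x ∷ map g xs)
      C = φ (f x ∷ map g xs)
      E = φ (f x ∷ map f xs)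
      G = δ (φ ▹ f x ▹ g x) (map g xs)
      Q = prism φ xs
      R = prism (δ (φ ▹ f x)) xs
      S = δ (prism (φ ▹ f x)) xs
      ring₁ : ∀ b c g q r s → (b - (c - g) - (q - r)) + (q - (g - s)) ≡ b - c + (r + s)
      ring₁ = solve-∀
      ring₂ : ∀ b c e → b - c + (c - e) ≡ b - e
      ring₂ = solve-∀

  module _ {X : Set} (ρ : X → X) where

    fold-suc : ∀ x a → fold (ρ x) ρ a ≡ ρ (fold x ρ a)
    fold-suc x zero    = refl
    fold-suc x (suc a) = cong ρ (fold-suc x a)

    fold-+ : ∀ x a b → fold (fold x ρ b) ρ a ≡ fold x ρ (a ℕ.+ b)
    fold-+ x zero    b = refl
    fold-+ x (suc a) b = cong ρ (fold-+ x a b)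

    fold-map-[] : ∀ a → fold [] (map ρ) a ≡ []
    fold-map-[] zero    = refl
    fold-map-[] (suc a) = cong (map ρ) (fold-map-[] a)

    fold-map-∷ : ∀ x xs a → fold (x ∷ xs) (map ρ) a ≡ fold x ρ a ∷ fold xs (map ρ) a
    fold-map-∷ x xs zero    = refl
    fold-map-∷ x xs (suc a) = cong (map ρ) (fold-map-∷ x xs a)

    fold-map-period : ∀ p → (∀ x → fold x ρ p ≡ x) → ∀ l → fold l (map ρ) p ≡ l
    fold-map-period p e []       = fold-map-[] p
    fold-map-period p e (x ∷ xs) = trans (fold-map-∷ x xs p) (cong₂ _∷_ (e x) (fold-map-period p e xs))

    Dup-fold : ∀ {l} → Dup l → ∀ a → Dup (fold l (map ρ) a)
    Dup-fold d zero    = d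
    Dup-fold d (suc a) = Dup-map ρ (Dup-fold d a)

  -- The two elements N = 1 + ρ + … + ρᵖ⁻¹ and Γ = ρ − 1 of the group ring of ℤ/p; their annihilating each other drives
  -- the periodic resolution behind the argument.
  module Action {X : Set} (ρ : X → X) (p : ℕ) (ρᵖ≗id : ∀ x → fold x ρ p ≡ x) where

    R : List X → List X
    R = map ρ

    Rᵖ≗id : ∀ l → fold l R p ≡ l
    Rᵖ≗id = fold-map-period ρ p ρᵖ≗id

    N Γ : Cochain X → Cochain X
    N φ l = sumN p λ a → φ (fold l R a)
    Γ φ l = φ (R l) - φ l

    W : Bool → Cochain X → Cochain X
    W true  = N
    W false = Γ

    W-linear : ∀ b l → Linear (λ φ → W b φ l)
    W-linear true  l = record
      { cong-≗ = λ e → sumN-cong p λ a _ → e (fold l R a)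
      ; minus  = λ φ ψ → sumN-minus p (λ a → φ (fold l R a)) (λ a → ψ (fold l R a)) }
    W-linear false l = record
      { cong-≗ = λ e → cong₂ _-_ (e (R l)) (e l)
      ; minus  = λ φ ψ → ring (φ (R l)) (ψ (R l)) (φ l) (ψ l) }
      where
      ring : ∀ a b c d → (a - b) - (c - d) ≡ (a - c) - (b - d)
      ring = solve-∀

    N-invariant : ∀ φ l → N φ (R l) ≡ N φ l
    N-invariant φ l = ℤ.i-j≡0⇒i≡j (N φ (R l)) (N φ l) (begin
      N φ (R l) - N φ l
        ≡⟨ sumN-minus p (λ a → φ (fold (R l) R a)) (λ a → φ (fold l R a)) ⟨
      sumN p (λ a → φ (fold (R l) R a) - φ (fold l R a))
        ≡⟨ sumN-cong p (λ a _ → cong (λ l′ → φ l′ - φ (fold l R a)) (fold-suc R l a)) ⟩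
      sumN p (λ a → φ (fold l R (suc a)) - φ (fold l R a))
        ≡⟨ sumN-telescope p (λ a → φ (fold l R a)) ⟩
      φ (fold l R p) - φ l
        ≡⟨ cong (λ l′ → φ l′ - φ l) (Rᵖ≗id l) ⟩
      φ l - φ l
        ≡⟨ ℤ.+-inverseʳ (φ l) ⟩
      0ℤ ∎)
      where open ≡-Reasoning

    W∘W : ∀ b φ l → W b (W (not b) φ) l ≡ 0ℤ
    W∘W true  φ l = trans (sumN-telescope p (λ a → φ (fold l R a)))
                          (trans (cong (λ l′ → φ l′ - φ l) (Rᵖ≗id l)) (ℤ.+-inverseʳ (φ l)))
    W∘W false φ l = trans (cong (_- N φ l) (N-invariant φ l)) (ℤ.+-inverseʳ (N φ l))

    δ-fold : ∀ φ a l → δ (λ l′ → φ (fold l′ R a)) l ≡ δ φ (fold l R a)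
    δ-fold φ zero    l = refl
    δ-fold φ (suc a) l = trans (δ-fold (φ ∘ R) a l) (δ-map ρ φ (fold l R a))

    δ∘W : ∀ b φ l → δ (W b φ) l ≡ W b (δ φ) l
    δ∘W true  φ l = trans (Linear.sums (δ-linear l) p (λ a l′ → φ (fold l′ R a)))
                          (sumN-cong p λ a _ → δ-fold φ a l)
    δ∘W false φ l = trans (Linear.minus (δ-linear l) (φ ∘ R) φ) (cong (_- δ φ l) (δ-map ρ φ l))

    W-normal : ∀ b {φ} → Normal φ → Normal (W b φ)
    W-normal true  n d = sumN-zero p λ a _ → n (Dup-fold ρ d a)
    W-normal false n d = cong₂ _-_ (n (Dup-map ρ d)) (n d)

  -- Explicit preimages under N and Γ on ℤ/p

  parity : ℕ → Bool
  parity zero    = true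
  parity (suc k) = not (parity k)

  module Rotation (p : ℕ) .{{_ : NonZero p}} where

    rot : Fin p → Fin p
    rot i = suc (toℕ i) mod p

    toℕ-mod : ∀ a → toℕ (a mod p) ≡ a % p
    toℕ-mod a = Fin.toℕ-fromℕ< (m%n<n a p)

    %-suc : ∀ a → suc (a % p) % p ≡ suc a % p
    %-suc a = begin
      (1 ℕ.+ a % p) % p                ≡⟨ %-distribˡ-+ 1 (a % p) p ⟩
      (1 % p ℕ.+ a % p % p) % p        ≡⟨ cong (λ z → (1 % p ℕ.+ z) % p) (m<n⇒m%n≡m (m%n<n a p)) ⟩
      (1 % p ℕ.+ a % p) % p            ≡⟨ %-distribˡ-+ 1 a p ⟨
      suc a % p                        ∎
      where open ≡-Reasoning

    rot-mod : ∀ a → rot (a mod p) ≡ suc a mod p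
    rot-mod a = Fin.toℕ-injective (begin
      toℕ (suc (toℕ (a mod p)) mod p)  ≡⟨ toℕ-mod (suc (toℕ (a mod p))) ⟩
      suc (toℕ (a mod p)) % p          ≡⟨ cong (λ z → suc z % p) (toℕ-mod a) ⟩
      suc (a % p) % p                  ≡⟨ %-suc a ⟩
      suc a % p                        ≡⟨ toℕ-mod (suc a) ⟨
      toℕ (suc a mod p)                ∎)
      where open ≡-Reasoning

    mod-toℕ : ∀ (i : Fin p) → toℕ i mod p ≡ i
    mod-toℕ i = Fin.toℕ-injective (trans (toℕ-mod (toℕ i)) (m<n⇒m%n≡m (Fin.toℕ<n i)))

    fold-rot : ∀ i a → fold i rot a ≡ (a ℕ.+ toℕ i) mod p
    fold-rot i zero    = sym (mod-toℕ i)
    fold-rot i (suc a) = trans (cong rot (fold-rot i a)) (rot-mod (a ℕ.+ toℕ i))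

    toℕ-fold-rot : ∀ i a → toℕ (fold i rot a) ≡ (a ℕ.+ toℕ i) % p
    toℕ-fold-rot i a = trans (cong toℕ (fold-rot i a)) (toℕ-mod (a ℕ.+ toℕ i))

    rotᵖ≗id : ∀ i → fold i rot p ≡ i
    rotᵖ≗id i = Fin.toℕ-injective (begin
      toℕ (fold i rot p)   ≡⟨ toℕ-fold-rot i p ⟩
      (p ℕ.+ toℕ i) % p    ≡⟨ cong (_% p) (ℕ.+-comm p (toℕ i)) ⟩
      (toℕ i ℕ.+ p) % p    ≡⟨ [m+n]%n≡m%n (toℕ i) p ⟩
      toℕ i % p            ≡⟨ m<n⇒m%n≡m (Fin.toℕ<n i) ⟩
      toℕ i                ∎)
      where open ≡-Reasoning

    unrot : Fin p → Fin p
    unrot i = fold i rot (p ∸ 1)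

    rot∘unrot : ∀ i → rot (unrot i) ≡ i
    rot∘unrot i = trans (cong (fold i rot) (ℕ.suc-pred p)) (rotᵖ≗id i)

    unrot∘rot : ∀ i → unrot (rot i) ≡ i
    unrot∘rot i = trans (fold-suc rot i (p ∸ 1)) (rot∘unrot i)

    rot-injective : ∀ {i j} → rot i ≡ rot j → i ≡ j
    rot-injective {i} {j} e = trans (sym (unrot∘rot i)) (trans (cong unrot e) (unrot∘rot j))

    open Action rot p rotᵖ≗id

    atZero : ℕ → ℤ → ℤ
    atZero zero    z = z
    atZero (suc _) z = 0ℤ

    -- The head of a nonempty list makes the rotation free, and the lists with head 0 form a
    -- fundamental domain. `solveN` cuts f down to this domain; `solveΓ` sums f along the orbit from
    -- its representative in the domain up to, but excluding, the given list. This makes N and Γ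
    -- exact against each other over ℤ, away from the fixed list `[]`.
    solveN solveΓ : Cochain (Fin p) → Cochain (Fin p)
    solveN f []      = 0ℤ
    solveN f (i ∷ l) = atZero (toℕ i) (f (i ∷ l))
    solveΓ f []      = 0ℤ
    solveΓ f (i ∷ l) = sumN (toℕ i) λ b → f (fold (fold (i ∷ l) R (p ∸ toℕ i)) R b)

    normalise-head : ∀ (i : Fin p) → toℕ (fold i rot (p ∸ toℕ i)) ≡ 0
    normalise-head i = begin
      toℕ (fold i rot (p ∸ toℕ i))   ≡⟨ toℕ-fold-rot i (p ∸ toℕ i) ⟩
      (p ∸ toℕ i ℕ.+ toℕ i) % p      ≡⟨ cong (_% p) (ℕ.m∸n+n≡m (ℕ.<⇒≤ (Fin.toℕ<n i))) ⟩
      p % p                          ≡⟨ n%n≡0 p ⟩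
      0                              ∎
      where open ≡-Reasoning

    module _ {f : Cochain (Fin p)} (f[] : f [] ≡ 0ℤ) where

      N-solveN : (∀ l → f (R l) ≡ f l) → ∀ l → N (solveN f) l ≡ f l
      N-solveN inv []      = trans (sumN-zero p λ a _ → cong (solveN f) (fold-map-[] rot a)) (sym f[])
      N-solveN inv (i ∷ l) = begin
        N (solveN f) (i ∷ l)                ≡⟨ shift (solveN f) (p ∸ toℕ i) (i ∷ l) ⟨
        N (solveN f) (fold (i ∷ l) R k)     ≡⟨ cong (N (solveN f)) (fold-map-∷ rot i l k) ⟩
        N (solveN f) (fold i rot k ∷ l′)    ≡⟨ at-zero (fold i rot k) l′ (normalise-head i) ⟩
        f (fold i rot k ∷ l′)               ≡⟨ cong f (fold-map-∷ rot i l k) ⟨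
        f (fold (i ∷ l) R k)                ≡⟨ inv* k (i ∷ l) ⟩
        f (i ∷ l)                           ∎
        where
        open ≡-Reasoning
        k = p ∸ toℕ i
        l′ = fold l R k
        shift : ∀ φ k l → N φ (fold l R k) ≡ N φ l
        shift φ zero    l = refl
        shift φ (suc k) l = trans (N-invariant φ (fold l R k)) (shift φ k l)
        inv* : ∀ k l → f (fold l R k) ≡ f l
        inv* zero    l = refl
        inv* (suc k) l = trans (inv (fold l R k)) (inv* k l)
        -- Starting from head 0, the heads met along the orbit are 0, 1, ..., p - 1, so only the
        -- first term survives.
        at-zero : ∀ i l → toℕ i ≡ 0 → N (solveN f) (i ∷ l) ≡ f (i ∷ l)
        at-zero i l i≡0 = begin
          N (solveN f) (i ∷ l)
            ≡⟨ cong (λ n → sumN n λ a → solveN f (fold (i ∷ l) R a)) (ℕ.suc-pred p) ⟨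
          sumN (suc (p ∸ 1)) (λ a → solveN f (fold (i ∷ l) R a))
            ≡⟨ sumN-head (p ∸ 1) (λ a a<p-1 → trans (cong (solveN f) (fold-map-∷ rot i l (suc a)))
                 (cong (λ n → atZero n (f (fold i rot (suc a) ∷ fold l R (suc a)))) (begin
                   toℕ (fold i rot (suc a))  ≡⟨ toℕ-fold-rot i (suc a) ⟩
                   (suc a ℕ.+ toℕ i) % p     ≡⟨ cong (λ z → (suc a ℕ.+ z) % p) i≡0 ⟩
                   (suc a ℕ.+ 0) % p         ≡⟨ cong (_% p) (ℕ.+-identityʳ (suc a)) ⟩
                   suc a % p                 ≡⟨ m<n⇒m%n≡m (subst (suc a <_) (ℕ.suc-pred p) (s≤s a<p-1)) ⟩
                   suc a                     ∎))) ⟩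
          atZero (toℕ i) (f (i ∷ l))
            ≡⟨ cong (λ n → atZero n (f (i ∷ l))) i≡0 ⟩
          f (i ∷ l) ∎

      Γ-solveΓ : (∀ l → N f l ≡ 0ℤ) → ∀ l → Γ (solveΓ f) l ≡ f l
      Γ-solveΓ Nf []      = sym f[]
      Γ-solveΓ Nf (i ∷ l) with suc (toℕ i) ℕ.<? p
      ... | yes i+1<p = begin
        solveΓ f (rot i ∷ R l) - S
          ≡⟨ cong (_- S) (cong (λ n → sumN n λ b → f (fold (fold (R l₀) R (p ∸ n)) R b)) rot-i) ⟩
        sumN (suc (toℕ i)) (λ b → f (fold (fold (R l₀) R (p ∸ suc (toℕ i))) R b)) - S
          ≡⟨ cong (λ z → sumN (suc (toℕ i)) (λ b → f (fold z R b)) - S) base ⟩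
        (S + f (fold l₁ R (toℕ i))) - S
          ≡⟨ ring S (f (fold l₁ R (toℕ i))) ⟩
        f (fold l₁ R (toℕ i))
          ≡⟨ cong f (trans (fold-+ R l₀ (toℕ i) (p ∸ toℕ i))
                           (trans (cong (fold l₀ R) (ℕ.m+[n∸m]≡n (ℕ.<⇒≤ (Fin.toℕ<n i)))) (Rᵖ≗id l₀))) ⟩
        f l₀ ∎
        where
        open ≡-Reasoning
        l₀ = i ∷ l
        l₁ = fold l₀ R (p ∸ toℕ i)
        S = sumN (toℕ i) λ b → f (fold l₁ R b)
        rot-i : toℕ (rot i) ≡ suc (toℕ i)
        rot-i = trans (toℕ-mod (suc (toℕ i))) (m<n⇒m%n≡m i+1<p)
        base : fold (R l₀) R (p ∸ suc (toℕ i)) ≡ l₁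
        base = trans (fold-suc R l₀ (p ∸ suc (toℕ i)))
                     (cong (fold l₀ R) (sym (ℕ.+-∸-assoc 1 {p} {suc (toℕ i)} (Fin.toℕ<n i))))
        ring : ∀ a b → (a + b) - a ≡ b
        ring = solve-∀
      -- The head wraps around to 0, where the partial sum is empty; that f sums to zero over the
      -- whole orbit supplies the missing term.
      ... | no i+1≮p = begin
        solveΓ f (rot i ∷ R l) - S
          ≡⟨ cong (_- S) (cong (λ n → sumN n λ b → f (fold (fold (R l₀) R (p ∸ n)) R b)) rot-i) ⟩
        0ℤ - S
          ≡⟨ cong (λ z → 0ℤ - sumN (toℕ i) λ b → f (fold (fold l₀ R z) R b)) p-i ⟩
        0ℤ - S′
          ≡⟨ cong (_- S′) (sym total) ⟩
        (S′ + f l₀) - S′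
          ≡⟨ ring S′ (f l₀) ⟩
        f l₀ ∎
        where
        open ≡-Reasoning
        l₀ = i ∷ l
        S = sumN (toℕ i) λ b → f (fold (fold l₀ R (p ∸ toℕ i)) R b)
        S′ = sumN (toℕ i) λ b → f (fold (R l₀) R b)
        i+1≡p : suc (toℕ i) ≡ p
        i+1≡p = ℕ.≤-antisym (Fin.toℕ<n i) (ℕ.≮⇒≥ i+1≮p)
        rot-i : toℕ (rot i) ≡ 0
        rot-i = trans (toℕ-mod (suc (toℕ i))) (trans (cong (_% p) i+1≡p) (n%n≡0 p))
        p-i : p ∸ toℕ i ≡ 1
        p-i = trans (cong (_∸ toℕ i) (sym i+1≡p)) (ℕ.m+n∸n≡m 1 (toℕ i))
        total : S′ + f l₀ ≡ 0ℤ
        total = begin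
          S′ + f l₀
            ≡⟨ cong (λ z → S′ + f z) (sym (trans (fold-suc R l₀ (toℕ i)) (trans (cong (fold l₀ R) i+1≡p) (Rᵖ≗id l₀)))) ⟩
          sumN (suc (toℕ i)) (λ b → f (fold (R l₀) R b))
            ≡⟨ cong (λ n → sumN n λ b → f (fold (R l₀) R b)) i+1≡p ⟩
          N f (R l₀)
            ≡⟨ Nf (R l₀) ⟩
          0ℤ ∎
        ring : ∀ a b → (a + b) - a ≡ b
        ring = solve-∀

    solve : Bool → Cochain (Fin p) → Cochain (Fin p)
    solve true  = solveN
    solve false = solveΓ

    W-solve : ∀ b {f} → f [] ≡ 0ℤ → (∀ l → W b f l ≡ 0ℤ) → ∀ l → W (not b) (solve (not b) f) l ≡ f l
    W-solve true  f[] e = Γ-solveΓ f[] e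
    W-solve false f[] e = N-solveN f[] λ l → ℤ.i-j≡0⇒i≡j _ _ (e l)

    solve-normal : ∀ b {f} → Normal f → Normal (solve b f)
    solve-normal true  {f} n {i ∷ l} d with toℕ i
    ... | zero  = n d
    ... | suc _ = refl
    solve-normal false {f} n {i ∷ l} d = sumN-zero (toℕ i) λ b _ → n (Dup-fold rot (Dup-fold rot d (p ∸ toℕ i)) b)

    one : Cochain (Fin p)
    one (_ ∷ []) = 1ℤ
    one _        = 0ℤ

    -- The staircase through the double complex of δ and the periodic resolution. It starts at the
    -- unit cocycle `one`; each further step takes a preimage of the last coboundary, under Γ and N
    -- in turn.
    ω : ℕ → Cochain (Fin p)
    ω zero    = solveN one
    ω (suc k) = solve (parity (suc k)) (δ (ω k))

    N-ω₀ : ∀ l → N (ω 0) l ≡ one l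
    N-ω₀ = N-solveN refl inv
      where
      inv : ∀ l → one (R l) ≡ one l
      inv []          = refl
      inv (_ ∷ [])    = refl
      inv (_ ∷ _ ∷ _) = refl

    δ-one : ∀ l → δ one l ≡ 0ℤ
    δ-one []                  = refl
    δ-one (_ ∷ [])            = refl
    δ-one (_ ∷ _ ∷ [])        = refl
    δ-one (i ∷ j ∷ k ∷ l)     = cong (λ z → 0ℤ - (0ℤ - z)) (Linear.zero-≗ (δ-linear (k ∷ l)) λ _ → refl)

    mutual
      -- Since δ commutes with W, it is applied to W (ω k), which is the cocycle `one` at the start
      -- and a coboundary later. This is the condition under which the next step of the staircase
      -- can be solved, whence the mutual recursion.
      W-δω : ∀ k l → W (parity k) (δ (ω k)) l ≡ 0ℤ
      W-δω zero    l = trans (sym (δ∘W true (ω 0) l)) (trans (Linear.cong-≗ (δ-linear l) N-ω₀) (δ-one l))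
      W-δω (suc k) l = trans (sym (δ∘W (parity (suc k)) (ω (suc k)) l))
                             (trans (Linear.cong-≗ (δ-linear l) (W-ω k)) (δ∘δ (ω k) l))

      W-ω : ∀ k l → W (parity (suc k)) (ω (suc k)) l ≡ δ (ω k) l
      W-ω k = W-solve (parity k) refl (W-δω k)

    ω-normal : ∀ k → Normal (ω k)
    ω-normal zero    = solve-normal true one-normal
      where
      one-normal : Normal one
      one-normal {_ ∷ _ ∷ _} _ = refl
      one-normal {_ ∷ []} (there ())
    ω-normal (suc k) = solve-normal (parity (suc k)) (δ-normal {φ = ω k} (ω-normal k))

  -- With chains h₀ = [v₀] and hₖ₊₁ = D (W hₖ), the number c k = ω k (W hₖ) is 1 at k = 0 and changes only by sign modulo p
  -- from k to k + 1; a nonzero value at k = n forces an n-cell with pairwise distinct consecutive labels.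
  module Index
    (p : ℕ) .{{_ : NonZero p}} (1<p : 1 < p)
    {V : Set} (ρ : V → V) (ρᵖ≗id : ∀ v → fold v ρ p ≡ v)
    (v₀ c : V)
    (D : Cochain V → Cochain V)
    (D-linear : ∀ l → Linear (λ φ → D φ l))
    (D-normal : ∀ {φ} → Normal φ → Normal (D φ))
    (D-homotopy : ∀ φ l → D (δ φ) l + δ (D φ) l ≡ φ (map (const c) l) - φ l)
    (Good : ℕ → List V → Set)
    (Good-length : ∀ {k l} → Good k l → length l ≡ suc k)
    (Good-v₀ : Good 0 (v₀ ∷ []))
    (Good-ρ : ∀ {k l} → Good k l → Good k (map ρ l))
    (D-vanish : ∀ {k φ} → (∀ {l} → Good (suc k) l → φ l ≡ 0ℤ) → ∀ {l} → Good k l → D φ l ≡ 0ℤ)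
    (s : V → Fin p) (n : ℕ)
    (s-ρ : ∀ {k l} → k ≤ n → Good k l → map s (map ρ l) ≡ map (Rotation.rot p) (map s l))
    where

    open Action ρ p ρᵖ≗id
    open Rotation p
    module Label = Action rot p rotᵖ≗id

    -- A chain is represented by the functional it induces on cochains, so operators on chains
    -- become precompositions. The factor W is included: `h k` is evaluation at W hₖ, not at hₖ.
    h : ℕ → Cochain V → ℤ
    h zero    φ = N φ (v₀ ∷ [])
    h (suc k) φ = h k (D (W (parity (suc k)) φ))

    h-linear : ∀ k → Linear (h k)
    h-linear zero    = W-linear true (v₀ ∷ [])
    h-linear (suc k) = record
      { cong-≗ = λ e → H.cong-≗ λ l → Linear.cong-≗ (D-linear l) λ l′ → Linear.cong-≗ (W-linear b l′) e
      ; minus  = λ φ ψ → trans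
          (H.cong-≗ λ l → trans (Linear.cong-≗ (D-linear l) λ l′ → Linear.minus (W-linear b l′) φ ψ)
                                (Linear.minus (D-linear l) (W b φ) (W b ψ)))
          (H.minus (D (W b φ)) (D (W b ψ))) }
      where
      b = parity (suc k)
      module H = Linear (h-linear k)

    Good-fold : ∀ {k l} → Good k l → ∀ a → Good k (fold l R a)
    Good-fold g zero    = g
    Good-fold g (suc a) = Good-ρ (Good-fold g a)

    W-vanish : ∀ b {k φ} → (∀ {l} → Good k l → φ l ≡ 0ℤ) → ∀ {l} → Good k l → W b φ l ≡ 0ℤ
    W-vanish true  e g = sumN-zero p λ a _ → e (Good-fold g a)
    W-vanish false e g = cong₂ _-_ (e (Good-ρ g)) (e g)

    h-vanish : ∀ k {φ} → (∀ {l} → Good k l → φ l ≡ 0ℤ) → h k φ ≡ 0ℤ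
    h-vanish zero    e = W-vanish true e Good-v₀
    h-vanish (suc k) e = h-vanish k (D-vanish (W-vanish (parity (suc k)) e))

    h-cong : ∀ k {φ ψ} → (∀ {l} → Good k l → φ l ≡ ψ l) → h k φ ≡ h k ψ
    h-cong k {φ} {ψ} e = ℤ.i-j≡0⇒i≡j (h k φ) (h k ψ) (trans (sym (Linear.minus (h-linear k) φ ψ))
      (h-vanish k λ {l} g → trans (cong (_- ψ l) (e g)) (ℤ.+-inverseʳ (ψ l))))

    -- The functional `h k` begins by applying W of the opposite kind.
    h∘W : ∀ k χ → h k (W (parity (suc k)) χ) ≡ 0ℤ
    h∘W zero    χ = W∘W true χ (v₀ ∷ [])
    h∘W (suc k) χ = Linear.zero-≗ (h-linear k) λ l → Linear.zero-≗ (D-linear l) (W∘W (parity (suc k)) χ)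

    -- In degree 0 the orbit of `v₀` contributes p equal terms; in higher degrees a constant list
    -- has a repetition.
    h-const : ∀ k {ψ} → Normal ψ → + p ∣ h k (λ l → ψ (map (const c) l))
    h-const zero    {ψ} _ = divides (ψ (c ∷ [])) (begin
      sumN p (λ a → ψ (map (const c) (fold (v₀ ∷ []) R a)))
        ≡⟨ sumN-cong p (λ a _ → cong (ψ ∘ map (const c))
             (trans (fold-map-∷ ρ v₀ [] a) (cong (fold v₀ ρ a ∷_) (fold-map-[] ρ a)))) ⟩
      sumN p (λ a → ψ (c ∷ []))
        ≡⟨ sumN-const p (ψ (c ∷ [])) ⟩
      + p * ψ (c ∷ [])
        ≡⟨ ℤ.*-comm (+ p) (ψ (c ∷ [])) ⟩
      ψ (c ∷ []) * + p ∎)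
      where open ≡-Reasoning
    h-const (suc k) {ψ} ν = divides 0ℤ (h-vanish (suc k) λ g → degenerate (Good-length g))
      where
      degenerate : ∀ {l} → length l ≡ suc (suc k) → ψ (map (const c) l) ≡ 0ℤ
      degenerate {_ ∷ _ ∷ _} _ = ν here

    h∘D∘δ : ∀ k {ψ} → Normal ψ → + p ∣ h k (D (δ ψ)) + h k ψ + h k (δ (D ψ))
    h∘D∘δ k {ψ} ν = subst (+ p ∣_) eq (h-const k ν)
      where
      ring₁ : ∀ x y u v → x + y ≡ u - v → u ≡ x + v + y
      ring₁ x y u v e = trans (lem u v) (trans (cong (_+ v) (sym e)) (lem′ x y v))
        where
        lem : ∀ u v → u ≡ u - v + v
        lem = solve-∀
        lem′ : ∀ x y v → x + y + v ≡ x + v + y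
        lem′ = solve-∀
      module H = Linear (h-linear k)
      eq : h k (λ l → ψ (map (const c) l)) ≡ h k (D (δ ψ)) + h k ψ + h k (δ (D ψ))
      eq = trans (H.cong-≗ λ l → ring₁ (D (δ ψ) l) (δ (D ψ) l) (ψ (map (const c) l)) (ψ l) (D-homotopy ψ l))
                 (trans (H.plus (λ l → D (δ ψ) l + ψ l) (δ (D ψ))) (cong (_+ h k (δ (D ψ))) (H.plus (D (δ ψ)) ψ)))

    -- The chains are cycles modulo p. In the induction δ moves past W, and the homotopy trades D δ
    -- for -1 - δ D up to a constant term: the first part dies by `h∘W`, the second by induction.
    h∘δ : ∀ k {χ} → Normal χ → + p ∣ h k (δ χ)
    h∘δ zero    {χ} _ = divides (χ []) (begin
      sumN p (λ a → δ χ (fold (v₀ ∷ []) R a))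
        ≡⟨ sumN-cong p (λ a _ → trans (cong (δ χ) (trans (fold-map-∷ ρ v₀ [] a) (cong (fold v₀ ρ a ∷_) (fold-map-[] ρ a))))
                                      (ℤ.+-identityʳ (χ []))) ⟩
      sumN p (λ a → χ [])
        ≡⟨ sumN-const p (χ []) ⟩
      + p * χ []
        ≡⟨ ℤ.*-comm (+ p) (χ []) ⟩
      χ [] * + p ∎)
      where open ≡-Reasoning
    h∘δ (suc k) {χ} ν = subst (+ p ∣_) eq (∣m∣n⇒∣m-n (h∘D∘δ k {W b χ} ν′) (h∘δ k (D-normal ν′)))
      where
      b = parity (suc k)
      ν′ = W-normal b {χ} ν
      ring : ∀ x y → x + 0ℤ + y - y ≡ x
      ring = solve-∀
      x = h k (D (δ (W b χ)))
      y = h k (δ (D (W b χ)))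
      eq : x + h k (W b χ) + y - y ≡ h k (D (W b (δ χ)))
      eq = trans (cong (λ z → x + z + y - y) (h∘W k χ))
                 (trans (ring x y) (Linear.cong-≗ (h-linear k) λ l → Linear.cong-≗ (D-linear l) (δ∘W b χ)))

    w : ℕ → Cochain V
    w k l = ω k (map s l)

    w-normal : ∀ k → Normal (w k)
    w-normal k d = ω-normal k (Dup-map s d)

    fold-label : ∀ {k l} → k ≤ n → Good k l → ∀ a → map s (fold l R a) ≡ fold (map s l) Label.R a
    fold-label k≤n g zero    = refl
    fold-label k≤n g (suc a) = trans (s-ρ k≤n (Good-fold g a)) (cong Label.R (fold-label k≤n g a))

    W-label : ∀ b {k} φ → k ≤ n → ∀ {l} → Good k l → W b (φ ∘ map s) l ≡ Label.W b φ (map s l)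
    W-label true  φ k≤n g = sumN-cong p λ a _ → cong φ (fold-label k≤n g a)
    W-label false φ k≤n {l} g = cong (λ l′ → φ l′ - φ (map s l)) (s-ρ k≤n g)

    δw : ∀ k → suc k ≤ n → ∀ {l} → Good (suc k) l → W (parity (suc k)) (w (suc k)) l ≡ δ (w k) l
    δw k k<n {l} g = trans (W-label (parity (suc k)) (ω (suc k)) k<n g) (trans (W-ω k (map s l)) (sym (δ-map s (ω k) l)))

    D-cong : ∀ {k φ ψ} → (∀ {l} → Good (suc k) l → φ l ≡ ψ l) → ∀ {l} → Good k l → D φ l ≡ D ψ l
    D-cong {k} {φ} {ψ} e {l} g = ℤ.i-j≡0⇒i≡j (D φ l) (D ψ l) (trans (sym (Linear.minus (D-linear l) φ ψ))
      (D-vanish {k} {φ ⊖ ψ} (λ {l} g → trans (cong (_- ψ l) (e g)) (ℤ.+-inverseʳ (ψ l))) g))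

    -- On good cells the staircase turns W (ω (k + 1)) into δ (ω k). The homotopy then returns -ω k,
    -- the remaining term vanishing modulo p on a cycle.
    c-step : ∀ k → suc k ≤ n → + p ∣ h (suc k) (w (suc k)) + h k (w k)
    c-step k k<n = subst (+ p ∣_) eq (∣m∣n⇒∣m-n (h∘D∘δ k (w-normal k)) (h∘δ k (D-normal (w-normal k))))
      where
      ring : ∀ x y z → x + y + z - z ≡ x + y
      ring = solve-∀
      eq : h k (D (δ (w k))) + h k (w k) + h k (δ (D (w k))) - h k (δ (D (w k))) ≡ h (suc k) (w (suc k)) + h k (w k)
      eq = trans (ring (h k (D (δ (w k)))) (h k (w k)) (h k (δ (D (w k)))))
                 (cong (_+ h k (w k)) (sym (h-cong k (D-cong (δw k k<n)))))

    c₀≡1 : h 0 (w 0) ≡ 1ℤ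
    c₀≡1 = trans (W-label true (ω 0) z≤n Good-v₀) (N-ω₀ (s v₀ ∷ []))

    p∤c : ∀ k → k ≤ n → ¬ + p ∣ h k (w k)
    p∤c zero    _   d = ℕ.<⇒≢ 1<p (sym (ℕ.∣1⇒≡1 (∣⇒∣ᵤ (subst (+ p ∣_) c₀≡1 d))))
    p∤c (suc k) k<n d = p∤c k (ℕ.<⇒≤ k<n) (subst (+ p ∣_) (ring (h (suc k) (w (suc k))) (h k (w k))) (∣m∣n⇒∣m-n (c-step k k<n) d))
      where
      ring : ∀ x y → x + y - x ≡ y
      ring = solve-∀

    ¬all-degenerate : ¬ (∀ {l} → Good n l → Dup (map s l))
    ¬all-degenerate e = p∤c n ℕ.≤-refl (divides 0ℤ (h-vanish n λ g → ω-normal n (e g)))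

-- Words and the sweeping cut

module _ where

  open import Data.Integer using (0ℤ; _+_; _-_)
  open import Data.Integer.Tactic.RingSolver using (solve-∀)
  open import Data.List using (_++_)
  open import Data.List.Membership.Propositional using (_∈_)
  open import Data.List.Membership.Propositional.Properties using (∈-map⁺; ∈-map⁻; ∈-++⁺ˡ; ∈-++⁺ʳ; ∈-++⁻)
  open import Data.List.Relation.Binary.Subset.Propositional using (_⊆_)
  open import Data.List.Relation.Unary.Any using (here; there)

  𝟙 : Bool → ℕ
  𝟙 b = if b then 1 else 0

  𝟙≤1 : ∀ b → 𝟙 b ≤ 1
  𝟙≤1 true  = ℕ.≤-refl
  𝟙≤1 false = z≤n

  jump : ∀ {q} → Fin q → Fin q → ℕ
  jump a b = 𝟙 (not ⌊ a ≟ b ⌋)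

  jump-refl : ∀ {q} (a : Fin q) → jump a a ≡ 0
  jump-refl a with a ≟ a
  ... | yes _  = refl
  ... | no a≢a = contradiction refl a≢a

  jump≤1 : ∀ {q} (a b : Fin q) → jump a b ≤ 1
  jump≤1 a b = 𝟙≤1 (not ⌊ a ≟ b ⌋)

  changes : ∀ {q n} → Vec (Fin q) n → ℕ
  changes []          = 0
  changes (a ∷ [])    = 0
  changes (a ∷ b ∷ x) = jump a b ℕ.+ changes (b ∷ x)

  changes-tail : ∀ {q n} (a : Fin q) (x : Vec (Fin q) n) → changes x ≤ changes (a ∷ x)
  changes-tail a []      = z≤n
  changes-tail a (b ∷ x) = ℕ.m≤n+m _ _

  changes-∷ : ∀ {q n} (a : Fin q) (x : Vec (Fin q) n) → changes (a ∷ x) ≤ suc (changes x)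
  changes-∷ a []      = z≤n
  changes-∷ a (b ∷ x) = ℕ.+-monoˡ-≤ (changes (b ∷ x)) (jump≤1 a b)

  changes-replicate : ∀ {q} n (a : Fin q) → changes (Vec.replicate n a) ≡ 0
  changes-replicate zero          a = refl
  changes-replicate (suc zero)    a = refl
  changes-replicate (suc (suc n)) a = cong₂ ℕ._+_ (jump-refl a) (changes-replicate (suc n) a)

  dist : ∀ {q n} → Vec (Fin q) n → Vec (Fin q) n → ℕ
  dist []      []      = 0
  dist (a ∷ x) (b ∷ y) = jump a b ℕ.+ dist x y

  dist-refl : ∀ {q n} (x : Vec (Fin q) n) → dist x x ≡ 0
  dist-refl []      = refl
  dist-refl (a ∷ x) = cong₂ ℕ._+_ (jump-refl a) (dist-refl x)

  jump-sym : ∀ {q} (a b : Fin q) → jump a b ≡ jump b a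
  jump-sym a b with a ≟ b | b ≟ a
  ... | yes _   | yes _   = refl
  ... | no _    | no _    = refl
  ... | yes a≡b | no b≢a  = contradiction (sym a≡b) b≢a
  ... | no a≢b  | yes b≡a = contradiction (sym b≡a) a≢b

  dist-sym : ∀ {q n} (x y : Vec (Fin q) n) → dist x y ≡ dist y x
  dist-sym []      []      = refl
  dist-sym (a ∷ x) (b ∷ y) = cong₂ ℕ._+_ (jump-sym a b) (dist-sym x y)

  module _ {q : ℕ} {f : Fin q → Fin q} (f-injective : ∀ {a b} → f a ≡ f b → a ≡ b) where

    jump-map : ∀ a b → jump (f a) (f b) ≡ jump a b
    jump-map a b with a ≟ b | f a ≟ f b
    ... | yes _   | yes _     = refl
    ... | no _    | no _      = refl
    ... | yes a≡b | no fa≢fb  = contradiction (cong f a≡b) fa≢fb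
    ... | no a≢b  | yes fa≡fb = contradiction (f-injective fa≡fb) a≢b

    changes-map : ∀ {n} (x : Vec (Fin q) n) → changes (Vec.map f x) ≡ changes x
    changes-map []          = refl
    changes-map (a ∷ [])    = refl
    changes-map (a ∷ b ∷ x) = cong₂ ℕ._+_ (jump-map a b) (changes-map (b ∷ x))

    dist-map : ∀ {n} (x y : Vec (Fin q) n) → dist (Vec.map f x) (Vec.map f y) ≡ dist x y
    dist-map []      []      = refl
    dist-map (a ∷ x) (b ∷ y) = cong₂ ℕ._+_ (jump-map a b) (dist-map x y)

  -- Clusters of words and their contraction

  module Contraction {p : ℕ} (o : Fin p) (L : ℕ) where

    Word : Set
    Word = Vec (Fin p) L

    prefix : ∀ {n} → ℕ → Vec (Fin p) n → Vec (Fin p) n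
    prefix zero    x       = x
    prefix (suc i) []      = []
    prefix (suc i) (a ∷ x) = o ∷ prefix i x

    prefix-all : ∀ {n} (x : Vec (Fin p) n) → prefix n x ≡ Vec.replicate n o
    prefix-all []      = refl
    prefix-all (a ∷ x) = cong (o ∷_) (prefix-all x)

    -- Only the border between the swept and the unswept beads can be a new change.
    changes-prefix : ∀ {n} i (x : Vec (Fin p) n) → changes (prefix i x) ≤ suc (changes x)
    changes-prefix zero    x = ℕ.n≤1+n _
    changes-prefix (suc i) [] = z≤n
    changes-prefix (suc zero) (a ∷ x) = ℕ.≤-trans (changes-∷ o x) (s≤s (changes-tail a x))
    changes-prefix (suc (suc i)) (a ∷ []) = z≤n
    changes-prefix (suc (suc i)) (a ∷ b ∷ x) = begin
      jump o o ℕ.+ changes (prefix (suc i) (b ∷ x))   ≡⟨ cong (ℕ._+ changes (prefix (suc i) (b ∷ x))) (jump-refl o) ⟩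
      changes (prefix (suc i) (b ∷ x))                ≤⟨ changes-prefix (suc i) (b ∷ x) ⟩
      suc (changes (b ∷ x))                           ≤⟨ s≤s (changes-tail a (b ∷ x)) ⟩
      suc (changes (a ∷ b ∷ x))                       ∎
      where open ℕ.≤-Reasoning

    dist-prefix : ∀ {n} i (x y : Vec (Fin p) n) → dist (prefix i x) (prefix i y) ≤ dist x y
    dist-prefix zero    x       y       = ℕ.≤-refl
    dist-prefix (suc i) []      []      = z≤n
    dist-prefix (suc i) (a ∷ x) (b ∷ y) =
      ℕ.+-mono-≤ (ℕ.≤-trans (ℕ.≤-reflexive (jump-refl o)) z≤n) (dist-prefix i x y)

    dist-prefix-suc : ∀ {n} i (x y : Vec (Fin p) n) → dist (prefix i x) (prefix (suc i) y) ≤ suc (dist x y)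
    dist-prefix-suc i       []      []      = subst (λ x → dist x [] ≤ 1) (prefix-[] i) z≤n
      where
      prefix-[] : ∀ i → [] ≡ prefix i []
      prefix-[] zero    = refl
      prefix-[] (suc i) = refl
    dist-prefix-suc zero    (a ∷ x) (b ∷ y) = ℕ.+-mono-≤ (jump≤1 a o) (ℕ.m≤n+m (dist x y) (jump a b))
    dist-prefix-suc (suc i) (a ∷ x) (b ∷ y) = begin
      jump o o ℕ.+ dist (prefix i x) (prefix (suc i) y)   ≡⟨ cong (ℕ._+ dist (prefix i x) (prefix (suc i) y)) (jump-refl o) ⟩
      dist (prefix i x) (prefix (suc i) y)                ≤⟨ dist-prefix-suc i x y ⟩
      suc (dist x y)                                      ≤⟨ s≤s (ℕ.m≤n+m (dist x y) (jump a b)) ⟩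
      suc (dist (a ∷ x) (b ∷ y))                          ∎
      where open ℕ.≤-Reasoning

    -- The same k bounds cuts and distances, and in `Good` it is also the dimension; this ties the
    -- budget of cuts to the degree in the index argument.
    record Cluster (k : ℕ) (S : List Word) : Set where
      constructor cluster
      field
        inhabited : ∃ λ x → x ∈ S
        few-cuts  : ∀ {x} → x ∈ S → changes x ≤ k
        close     : ∀ {x y} → x ∈ S → y ∈ S → dist x y ≤ k

    open Cluster

    Good : ℕ → List (List Word) → Set
    Good k l = length l ≡ suc k × Linked _⊆_ l × All (Cluster k) l

    -- What makes the prism of a k-cell consist of (k + 1)-cells: `f⊆g` joins the two halves of f x₀
    -- ⊆ ... ⊆ f xᵢ ⊆ g xᵢ ⊆ ... ⊆ g xₙ.
    record Step (f g : List Word → List Word) : Set where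
      field
        f-mono    : ∀ {S S′} → S ⊆ S′ → f S ⊆ f S′
        g-mono    : ∀ {S S′} → S ⊆ S′ → g S ⊆ g S′
        f⊆g       : ∀ {k S} → Cluster k S → f S ⊆ g S
        f-cluster : ∀ {k S} → Cluster k S → Cluster (suc k) (f S)
        g-cluster : ∀ {k S} → Cluster k S → Cluster (suc k) (g S)

    module _ {f g : List Word → List Word} (st : Step f g) where
      open Step st

      private
        cell-length : ∀ {xs l} → PrismCell f g xs l → length l ≡ suc (length xs)
        cell-length (here {xs = xs}) = cong (λ n → 2 ℕ.+ n) (List.length-map g xs)
        cell-length (there c) = cong suc (cell-length c)

        cell-linked : ∀ {k xs l} → PrismCell f g xs l → All (Cluster k) xs → Linked _⊆_ xs → Linked _⊆_ l
        cell-linked (here {xs = xs}) (c ∷ _) lk = f⊆g c ∷ Linked.map⁺ (Linked.map g-mono lk)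
        cell-linked (there here)        (_ ∷ cs) (r ∷ lk) = f-mono r ∷ cell-linked here cs lk
        cell-linked (there (there c))   (_ ∷ cs) (r ∷ lk) = f-mono r ∷ cell-linked (there c) cs lk

        cell-clusters : ∀ {k xs l} → PrismCell f g xs l → All (Cluster k) xs → All (Cluster (suc k)) l
        cell-clusters here      (c ∷ cs) = f-cluster c ∷ g-cluster c ∷ All.map⁺ (All.map g-cluster cs)
        cell-clusters (there d) (c ∷ cs) = f-cluster c ∷ cell-clusters d cs

      prism-good : ∀ {k φ} → (∀ {l} → Good (suc k) l → φ l ≡ 0ℤ) → ∀ {l} → Good k l → prism f g φ l ≡ 0ℤ
      prism-good e {l} (len , lk , cs) = prism-vanish f g _ l λ c →
        e (trans (cell-length c) (cong suc len) , cell-linked c cs lk , cell-clusters c cs)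

    T U : ℕ → List Word → List Word
    T i S = List.map (prefix i) S
    U i S = T i S ++ T (suc i) S

    o* : Word
    o* = Vec.replicate L o

    C : List Word → List Word
    C _ = o* ∷ []

    cluster-≤ : ∀ {k} → Cluster k (o* ∷ [])
    cluster-≤ = cluster (o* , here refl)
      (λ { (here refl) → ℕ.≤-trans (ℕ.≤-reflexive (changes-replicate L o)) z≤n })
      (λ { (here refl) (here refl) → ℕ.≤-trans (ℕ.≤-reflexive (dist-refl o*)) z≤n })

    T-cluster : ∀ i {k S} → Cluster k S → Cluster (suc k) (T i S)
    T-cluster i {k} {S} c = cluster (_ , ∈-map⁺ (prefix i) (proj₂ (inhabited c))) few cl
      where
      few : ∀ {x} → x ∈ T i S → changes x ≤ suc k
      few m with _ , x∈ , refl ← ∈-map⁻ (prefix i) m = ℕ.≤-trans (changes-prefix i _) (s≤s (few-cuts c x∈))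
      cl : ∀ {x y} → x ∈ T i S → y ∈ T i S → dist x y ≤ suc k
      cl m m′ with _ , x∈ , refl ← ∈-map⁻ (prefix i) m | _ , y∈ , refl ← ∈-map⁻ (prefix i) m′ =
        ℕ.≤-trans (dist-prefix i _ _) (ℕ.m≤n⇒m≤1+n (close c x∈ y∈))

    U-cluster : ∀ i {k S} → Cluster k S → Cluster (suc k) (U i S)
    U-cluster i {k} {S} c = cluster (_ , ∈-++⁺ˡ (proj₂ (inhabited Ti))) few cl
      where
      Ti = T-cluster i c
      Ti+1 = T-cluster (suc i) c
      few : ∀ {x} → x ∈ U i S → changes x ≤ suc k
      few m with ∈-++⁻ (T i S) m
      ... | inj₁ m′ = few-cuts Ti m′
      ... | inj₂ m′ = few-cuts Ti+1 m′
      mixed : ∀ {x y} → x ∈ T i S → y ∈ T (suc i) S → dist x y ≤ suc k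
      mixed m m′ with _ , x∈ , refl ← ∈-map⁻ (prefix i) m | _ , y∈ , refl ← ∈-map⁻ (prefix (suc i)) m′ =
        ℕ.≤-trans (dist-prefix-suc i _ _) (s≤s (close c x∈ y∈))
      cl : ∀ {x y} → x ∈ U i S → y ∈ U i S → dist x y ≤ suc k
      cl {x} {y} m m′ with ∈-++⁻ (T i S) m | ∈-++⁻ (T i S) m′
      ... | inj₁ a | inj₁ b = close Ti a b
      ... | inj₁ a | inj₂ b = mixed a b
      ... | inj₂ a | inj₁ b = subst (_≤ suc k) (dist-sym y x) (mixed b a)
      ... | inj₂ a | inj₂ b = close Ti+1 a b

    T-mono : ∀ i {S S′} → S ⊆ S′ → T i S ⊆ T i S′
    T-mono i = Subset.map⁺ (prefix i)

    U-mono : ∀ i {S S′} → S ⊆ S′ → U i S ⊆ U i S′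
    U-mono i e = Subset.++⁺ (T-mono i e) (T-mono (suc i) e)

    step-left : ∀ i → Step (T i) (U i)
    step-left i = record
      { f-mono = T-mono i ; g-mono = U-mono i ; f⊆g = λ _ → ∈-++⁺ˡ
      ; f-cluster = T-cluster i ; g-cluster = U-cluster i }

    step-right : ∀ i → Step (T (suc i)) (U i)
    step-right i = record
      { f-mono = T-mono (suc i) ; g-mono = U-mono i ; f⊆g = λ {_} {S} _ → ∈-++⁺ʳ (T i S)
      ; f-cluster = T-cluster (suc i) ; g-cluster = U-cluster i }

    -- The words of `T L S` are all equal to `o*`, but their number depends on S. One more prism is
    -- needed to reach a map that is literally constant; it uses that a cluster is inhabited.
    step-end : Step C (T L)
    step-end = record
      { f-mono = λ _ m → m ; g-mono = T-mono L
      ; f⊆g = λ { {_} {S} c (here refl) →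
          subst (_∈ T L S) (prefix-all (proj₁ (inhabited c))) (∈-map⁺ (prefix L) (proj₂ (inhabited c))) }
      ; f-cluster = λ _ → cluster-≤ ; g-cluster = T-cluster L }

    -- The zigzag id = T 0 ⊆ U 0 ⊇ T 1 ⊆ U 1 ⊇ … ⊇ T L ⊇ C: a cut sweeps the necklace from left to right, giving
    -- everything it has passed to the thief o.
    D : Cochain (List Word) → Cochain (List Word)
    D φ l = sumN L (λ i → prism (T i) (U i) φ l - prism (T (suc i)) (U i) φ l) - prism C (T L) φ l

    private
      module left  i l = Linear (prism-linear (T i) (U i) l)
      module right i l = Linear (prism-linear (T (suc i)) (U i) l)
      module end     l = Linear (prism-linear C (T L) l)

      ring₁ : ∀ a b c d → (a - b) - (c - d) ≡ (a - c) - (b - d)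
      ring₁ = solve-∀

    D-linear : ∀ l → Linear (λ φ → D φ l)
    D-linear l = record
      { cong-≗ = λ e → cong₂ _-_ (sumN-cong L λ i _ → cong₂ _-_ (left.cong-≗ i l e) (right.cong-≗ i l e)) (end.cong-≗ l e)
      ; minus  = λ φ ψ → trans
          (cong₂ _-_
            (trans (sumN-cong L λ i _ → trans (cong₂ _-_ (left.minus i l φ ψ) (right.minus i l φ ψ))
                     (ring₁ (prism (T i) (U i) φ l) (prism (T i) (U i) ψ l)
                            (prism (T (suc i)) (U i) φ l) (prism (T (suc i)) (U i) ψ l)))
                   (sumN-minus L (λ i → prism (T i) (U i) φ l - prism (T (suc i)) (U i) φ l)
                                 (λ i → prism (T i) (U i) ψ l - prism (T (suc i)) (U i) ψ l)))
            (end.minus l φ ψ))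
          (ring₁ (sumN L λ i → prism (T i) (U i) φ l - prism (T (suc i)) (U i) φ l)
                 (sumN L λ i → prism (T i) (U i) ψ l - prism (T (suc i)) (U i) ψ l)
                 (prism C (T L) φ l) (prism C (T L) ψ l)) }

    D-normal : ∀ {φ} → Normal φ → Normal (D φ)
    D-normal {φ} ν d = cong₂ _-_
      (sumN-zero L λ i _ → cong₂ _-_ (prism-normal (T i) (U i) {φ} ν d) (prism-normal (T (suc i)) (U i) {φ} ν d))
      (prism-normal C (T L) {φ} ν d)

    D-vanish : ∀ {k φ} → (∀ {l} → Good (suc k) l → φ l ≡ 0ℤ) → ∀ {l} → Good k l → D φ l ≡ 0ℤ
    D-vanish e g = cong₂ _-_
      (sumN-zero L λ i _ → cong₂ _-_ (prism-good (step-left i) e g) (prism-good (step-right i) e g))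
      (prism-good step-end e g)

    D-homotopy : ∀ φ l → D (δ φ) l + δ (D φ) l ≡ φ (List.map C l) - φ l
    D-homotopy φ l = begin
      (sumN L A - E) + δ (D φ) l
        ≡⟨ cong (λ z → sumN L A - E + z) (trans (Linear.minus (δ-linear l) (λ l → sumN L λ i → a i l) (prism C (T L) φ))
             (cong (_- E′) (trans (Linear.sums (δ-linear l) L a)
               (sumN-cong L λ i _ → Linear.minus (δ-linear l) (prism (T i) (U i) φ) (prism (T (suc i)) (U i) φ))))) ⟩
      (sumN L A - E) + (sumN L B - E′)
        ≡⟨ ring₂ (sumN L A) E (sumN L B) E′ ⟩
      (sumN L A + sumN L B) - (E + E′)
        ≡⟨ cong₂ _-_ (sym (sumN-plus L A B)) (prism-homotopy C (T L) φ l) ⟩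
      sumN L (λ i → A i + B i) - (t L - c)
        ≡⟨ cong (_- (t L - c)) (sumN-cong L λ i _ → pair i) ⟩
      sumN L (λ i → t (suc i) - t i) - (t L - c)
        ≡⟨ cong (_- (t L - c)) (sumN-telescope L t) ⟩
      (t L - t 0) - (t L - c)
        ≡⟨ ring₃ (t L) (t 0) c ⟩
      c - t 0
        ≡⟨ cong (λ l′ → c - φ l′) (trans (List.map-cong List.map-id l) (List.map-id l)) ⟩
      c - φ l ∎
      where
      open ≡-Reasoning
      a : ℕ → Cochain (List Word)
      a i = prism (T i) (U i) φ ⊖ prism (T (suc i)) (U i) φ
      A B t : ℕ → ℤ
      A i = prism (T i) (U i) (δ φ) l - prism (T (suc i)) (U i) (δ φ) l
      B i = δ (prism (T i) (U i) φ) l - δ (prism (T (suc i)) (U i) φ) l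
      t i = φ (List.map (T i) l)
      c  = φ (List.map C l)
      E  = prism C (T L) (δ φ) l
      E′ = δ (prism C (T L) φ) l
      ring₂ : ∀ a e b f → (a - e) + (b - f) ≡ (a + b) - (e + f)
      ring₂ = solve-∀
      ring₃ : ∀ a b c → (a - b) - (a - c) ≡ c - b
      ring₃ = solve-∀
      ring₄ : ∀ a b c d → (a - b) + (c - d) ≡ (a + c) - (b + d)
      ring₄ = solve-∀
      ring₅ : ∀ u v w → (u - v) - (u - w) ≡ w - v
      ring₅ = solve-∀
      pair : ∀ i → A i + B i ≡ t (suc i) - t i
      pair i = begin
        A i + B i
          ≡⟨ ring₄ (prism (T i) (U i) (δ φ) l) (prism (T (suc i)) (U i) (δ φ) l)
                   (δ (prism (T i) (U i) φ) l) (δ (prism (T (suc i)) (U i) φ) l) ⟩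
        (prism (T i) (U i) (δ φ) l + δ (prism (T i) (U i) φ) l) -
        (prism (T (suc i)) (U i) (δ φ) l + δ (prism (T (suc i)) (U i) φ) l)
          ≡⟨ cong₂ _-_ (prism-homotopy (T i) (U i) φ l) (prism-homotopy (T (suc i)) (U i) φ l) ⟩
        (φ (List.map (U i) l) - t i) - (φ (List.map (U i) l) - t (suc i))
          ≡⟨ ring₅ (φ (List.map (U i) l)) (t i) (t (suc i)) ⟩
        t (suc i) - t i ∎

-- Almost fair splittings

module _ where

  open import Data.Nat using (_+_; _*_)
  open import Data.Nat.Coprimality using (coprime-Bézout; prime⇒coprime)
  open import Data.Nat.GCD using (module Bézout)
  open import Data.Nat.ListAction using (product)
  open import Data.Nat.Primality using (Prime; prime⇒nonTrivial; prime⇒nonZero)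
  open import Data.Nat.Primality.Factorisation using (factorise; module PrimeFactorisation)
  open import Data.Nat.Tactic.RingSolver using (solve-∀)
  open import Data.Fin.Permutation using (permutation)
  open import Data.List.Membership.Propositional using (_∈_; find; lose)
  open import Data.List.Membership.Propositional.Properties using (∈-map⁺; ∈-map⁻)
  open import Data.List.Relation.Binary.Subset.Propositional using (_⊆_)
  open import Data.List.Relation.Unary.Any using (here; there; any?)

  sum-mono : ∀ {n} {f g : Fin n → ℕ} → (∀ i → f i ≤ g i) → sum f ≤ sum g
  sum-mono {zero}  e = z≤n
  sum-mono {suc n} e = ℕ.+-mono-≤ (e zero) (sum-mono (e ∘ suc))

  sum-const : ∀ n c → sum {n} (λ _ → c) ≡ n * c
  sum-const zero    c = refl
  sum-const (suc n) c = cong (c +_) (sum-const n c)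

  ≤-sum : ∀ {n} (f : Fin n → ℕ) i → f i ≤ sum f
  ≤-sum f zero    = ℕ.m≤m+n _ _
  ≤-sum f (suc i) = ℕ.≤-trans (≤-sum (f ∘ suc) i) (ℕ.m≤n+m _ _)

  sum≡⇒≗ : ∀ {n} {f g : Fin n → ℕ} → (∀ i → f i ≤ g i) → sum g ≤ sum f → ∀ i → f i ≡ g i
  sum≡⇒≗ {suc n} {f} {g} f≤g e zero    =
    ℕ.≤-antisym (f≤g zero) (ℕ.+-cancelʳ-≤ (sum (g ∘ suc)) _ _ (ℕ.≤-trans e (ℕ.+-monoʳ-≤ (f zero) (sum-mono (f≤g ∘ suc)))))
  sum≡⇒≗ {suc n} {f} {g} f≤g e (suc i) =
    sum≡⇒≗ (f≤g ∘ suc) (ℕ.+-cancelˡ-≤ (g zero) _ _ (ℕ.≤-trans e (ℕ.+-monoˡ-≤ (sum (f ∘ suc)) (f≤g zero)))) i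

  size : ∀ {n} → (Fin n → Bool) → ℕ
  size T = sum (𝟙 ∘ T)

  size≤ : ∀ {n} (T : Fin n → Bool) → size T ≤ n
  size≤ {n} T = subst (size T ≤_) (trans (sum-const n 1) (ℕ.*-identityʳ n)) (sum-mono (𝟙≤1 ∘ T))

  size-full : ∀ {n} (T : Fin n → Bool) → n ≤ size T → ∀ t → T t ≡ true
  size-full {n} T n≤ t with T t | sum≡⇒≗ (𝟙≤1 ∘ T) (subst (_≤ size T) (sym (trans (sum-const n 1) (ℕ.*-identityʳ n))) n≤) t
  ... | true  | _ = refl

  size-pos : ∀ {n} (T : Fin n → Bool) {t} → T t ≡ true → 0 < size T
  size-pos T {t} e = ℕ.≤-trans (ℕ.≤-reflexive (sym (cong 𝟙 e))) (≤-sum (𝟙 ∘ T) t)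

  -- Equivariant selection of a thief

  module Selection (p : ℕ) .{{_ : NonZero p}} (prime : Prime p) where

    open Rotation p

    sum-rot : ∀ f → sum {p} f ≡ sum (f ∘ rot)
    sum-rot f = sum-permute f (permutation rot unrot rot∘unrot unrot∘rot)

    weight : (Fin p → Bool) → ℕ
    weight T = sum λ t → 𝟙 (T t) * toℕ t

    module _ {T T′ : Fin p → Bool} (T′∘rot : ∀ t → T′ (rot t) ≡ T t) where

      size-rot : size T′ ≡ size T
      size-rot = trans (sum-rot (𝟙 ∘ T′)) (sum-cong-≗ λ t → cong 𝟙 (T′∘rot t))

      -- Every element moves up by one except that p - 1 drops to 0; the multiples of p collected in
      -- `g` restore this carry.
      weight-rot : weight T′ % p ≡ (weight T + size T) % p
      weight-rot = begin
        weight T′ % p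
          ≡⟨ cong (_% p) (trans (sum-rot (λ t → 𝟙 (T′ t) * toℕ t))
                                (sum-cong-≗ λ t → cong₂ (λ b u → 𝟙 b * u) (T′∘rot t) (toℕ-mod (suc (toℕ t))))) ⟩
        sum f % p
          ≡⟨ [m+kn]%n≡m%n (sum f) (sum g) p ⟨
        (sum f + sum g * p) % p
          ≡⟨ cong (λ z → (sum f + z) % p) (*-distribʳ-sum p g) ⟩
        (sum f + sum (λ t → g t * p)) % p
          ≡⟨ cong (_% p) (∑-distrib-+ f (λ t → g t * p)) ⟨
        sum (λ t → f t + g t * p) % p
          ≡⟨ cong (_% p) (sum-cong-≗ carry) ⟩
        sum (λ t → 𝟙 (T t) * toℕ t + 𝟙 (T t)) % p
          ≡⟨ cong (_% p) (∑-distrib-+ (λ t → 𝟙 (T t) * toℕ t) (𝟙 ∘ T)) ⟩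
        (weight T + size T) % p ∎
        where
        open ≡-Reasoning
        f g : Fin p → ℕ
        f t = 𝟙 (T t) * (suc (toℕ t) % p)
        g t = 𝟙 (T t) * (suc (toℕ t) / p)
        ring₁ : ∀ b r q p → b * r + b * q * p ≡ b * (r + q * p)
        ring₁ = solve-∀
        ring₂ : ∀ b t → b * (1 + t) ≡ b * t + b
        ring₂ = solve-∀
        carry : ∀ t → f t + g t * p ≡ 𝟙 (T t) * toℕ t + 𝟙 (T t)
        carry t = trans (ring₁ (𝟙 (T t)) (suc (toℕ t) % p) (suc (toℕ t) / p) p)
                  (trans (cong (𝟙 (T t) *_) (sym (m≡m%n+[m/n]*n (suc (toℕ t)) p))) (ring₂ (𝟙 (T t)) (toℕ t)))

    -- The conditions on k stand below the existential, so the witness depends on k alone and `mean`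
    -- is total.
    inverse : ∀ k → ∃ λ i → 0 < k → k < p → (i * k) % p ≡ 1 % p
    inverse zero      = 0 , λ ()
    inverse k@(suc _) with k ℕ.<? p
    ... | no k≮p  = 0 , λ _ k<p → contradiction k<p k≮p
    ... | yes k<p with coprime-Bézout (prime⇒coprime prime k<p)
    ...   | Bézout.-+ x y e = y , λ _ _ → trans (cong (_% p) (sym e)) ([m+kn]%n≡m%n 1 x p)
    -- Here y k ≡ -1 modulo p, and the factor p - 1 corrects the sign.
    ...   | Bézout.+- x y e = (p ∸ 1) * y , λ _ _ → begin
      ((p ∸ 1) * y * k) % p              ≡⟨ [m+kn]%n≡m%n ((p ∸ 1) * y * k) x p ⟨
      ((p ∸ 1) * y * k + x * p) % p      ≡⟨ cong (λ z → ((p ∸ 1) * y * k + z) % p) (sym e) ⟩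
      ((p ∸ 1) * y * k + (1 + y * k)) % p ≡⟨ cong (_% p) (ring (p ∸ 1) y k) ⟩
      (1 + y * k * suc (p ∸ 1)) % p      ≡⟨ cong (λ z → (1 + y * k * z) % p) (ℕ.suc-pred p) ⟩
      (1 + y * k * p) % p                ≡⟨ [m+kn]%n≡m%n 1 (y * k) p ⟩
      1 % p                              ∎
      where
      open ≡-Reasoning
      ring : ∀ q y k → q * y * k + (1 + y * k) ≡ 1 + y * k * (1 + q)
      ring = solve-∀

    -- The mean of T in ℤ/p: it turns with T because a proper nonempty T has invertible size.
    mean : (Fin p → Bool) → Fin p
    mean T = (proj₁ (inverse (size T)) * weight T) mod p

    mean-cong : ∀ {T T′} → T ≗ T′ → mean T ≡ mean T′
    mean-cong e = cong₂ (λ u v → (proj₁ (inverse u) * v) mod p) (sum-cong-≗ λ t → cong 𝟙 (e t))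
                        (sum-cong-≗ λ t → cong (λ b → 𝟙 b * toℕ t) (e t))

    mean-rot : ∀ {T T′} → (∀ t → T′ (rot t) ≡ T t) → 0 < size T → size T < p → mean T′ ≡ rot (mean T)
    mean-rot {T} {T′} e 0<T T<p = Fin.toℕ-injective (begin
      toℕ (mean T′)
        ≡⟨ toℕ-mod (proj₁ (inverse (size T′)) * weight T′) ⟩
      (proj₁ (inverse (size T′)) * weight T′) % p
        ≡⟨ cong (λ z → (proj₁ (inverse z) * weight T′) % p) (size-rot {T} {T′} e) ⟩
      (i * weight T′) % p
        ≡⟨ %-distribˡ-* i (weight T′) p ⟩
      (i % p * (weight T′ % p)) % p
        ≡⟨ cong (λ z → (i % p * z) % p) (weight-rot {T} {T′} e) ⟩
      (i % p * ((weight T + size T) % p)) % p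
        ≡⟨ %-distribˡ-* i (weight T + size T) p ⟨
      (i * (weight T + size T)) % p
        ≡⟨ cong (_% p) (trans (ℕ.*-distribˡ-+ i (weight T) (size T)) (ℕ.+-comm (i * weight T) (i * size T))) ⟩
      (i * size T + i * weight T) % p
        ≡⟨ %-distribˡ-+ (i * size T) (i * weight T) p ⟩
      ((i * size T) % p + (i * weight T) % p) % p
        ≡⟨ cong (λ z → (z + (i * weight T) % p) % p) (proj₂ (inverse (size T)) 0<T T<p) ⟩
      (1 % p + (i * weight T) % p) % p
        ≡⟨ %-distribˡ-+ 1 (i * weight T) p ⟨
      suc (i * weight T) % p
        ≡⟨ toℕ-mod (suc (i * weight T)) ⟨
      toℕ (suc (i * weight T) mod p)
        ≡⟨ cong toℕ (rot-mod (i * weight T)) ⟨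
      toℕ (rot (mean T)) ∎)
      where
      open ≡-Reasoning
      i = proj₁ (inverse (size T))

    -- Rotation preserves the sizes of the columns, hence also which column is the first nonempty
    -- one. The value for an entirely empty table is a placeholder.
    select : ∀ {m} → (Fin m → Fin p → Bool) → Fin p
    select {zero}  Λ = 0 mod p
    select {suc m} Λ with size (Λ zero)
    ... | zero  = select (Λ ∘ suc)
    ... | suc _ = mean (Λ zero)

    select-cong : ∀ {m} {Λ Λ′ : Fin m → Fin p → Bool} → (∀ j t → Λ j t ≡ Λ′ j t) → select Λ ≡ select Λ′
    select-cong {zero}  e = refl
    select-cong {suc m} {Λ} {Λ′} e with size (Λ zero) | size (Λ′ zero) | sum-cong-≗ {p} (λ t → cong 𝟙 (e zero t))
    ... | zero  | .zero    | refl = select-cong (e ∘ suc)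
    ... | suc _ | .(suc _) | refl = mean-cong (e zero)

    select-rot : ∀ {m} {Λ Λ′ : Fin m → Fin p → Bool} → (∀ j t → Λ′ j (rot t) ≡ Λ j t) →
                 (∃ λ j → 0 < size (Λ j)) → (∀ j → size (Λ j) < p) → select Λ′ ≡ rot (select Λ)
    select-rot {suc m} {Λ} {Λ′} e ne nf
      with size (Λ zero) in eq | size (Λ′ zero) | size-rot {Λ zero} {Λ′ zero} (e zero)
    ... | suc _ | .(suc _) | refl = mean-rot (e zero) (subst (0 <_) (sym eq) (s≤s z≤n)) (nf zero)
    ... | zero  | .zero    | refl with ne
    ...   | zero  , 0<  = contradiction (subst (0 <_) eq 0<) λ ()
    ...   | suc j , 0<  = select-rot (e ∘ suc) (j , 0<) (nf ∘ suc)

  ⌊⌋-intro : ∀ {P : Set} (d : Dec P) → P → ⌊ d ⌋ ≡ true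
  ⌊⌋-intro (yes _) _ = refl
  ⌊⌋-intro (no ¬p) p = contradiction p ¬p

  ⌊⌋-elim : ∀ {P : Set} (d : Dec P) → ⌊ d ⌋ ≡ true → P
  ⌊⌋-elim (yes p) _ = p

  ⌊⌋-⇔ : ∀ {P Q : Set} (d : Dec P) (e : Dec Q) → (P → Q) → (Q → P) → ⌊ d ⌋ ≡ ⌊ e ⌋
  ⌊⌋-⇔ (yes p) e f g = sym (⌊⌋-intro e (f p))
  ⌊⌋-⇔ (no ¬p) (yes q) f g = contradiction (g q) ¬p
  ⌊⌋-⇔ (no ¬p) (no _)  f g = refl

  -- Counting beads and shares

  count : ∀ {A : Set} {n} → (A → Bool) → Vec A n → ℕ
  count f []      = 0
  count f (a ∷ x) = 𝟙 (f a) + count f x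

  count≤ : ∀ {A : Set} {n} (f : A → Bool) (x : Vec A n) → count f x ≤ n
  count≤ f []      = z≤n
  count≤ f (a ∷ x) = ℕ.+-mono-≤ (𝟙≤1 (f a)) (count≤ f x)

  beads : ∀ {m n} → Vec (Fin m) n → Fin m → ℕ
  beads col j = count (λ c → ⌊ c ≟ j ⌋) col

  share : ∀ {m q n} → Vec (Fin m) n → Vec (Fin q) n → Fin m → Fin q → ℕ
  share col x j t = count (λ (c , u) → ⌊ c ≟ j ⌋ ∧ ⌊ u ≟ t ⌋) (Vec.zip col x)

  share-dist : ∀ {m q n} (col : Vec (Fin m) n) (x y : Vec (Fin q) n) j t → share col x j t ≤ share col y j t + dist x y
  share-dist []        []      []      j t = z≤n
  share-dist (c ∷ col) (a ∷ x) (b ∷ y) j t = begin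
    𝟙 (i ∧ ⌊ a ≟ t ⌋) + share col x j t
      ≤⟨ ℕ.+-mono-≤ one-bead (share-dist col x y j t) ⟩
    (𝟙 (i ∧ ⌊ b ≟ t ⌋) + jump a b) + (share col y j t + dist x y)
      ≡⟨ ring (𝟙 (i ∧ ⌊ b ≟ t ⌋)) (jump a b) (share col y j t) (dist x y) ⟩
    (𝟙 (i ∧ ⌊ b ≟ t ⌋) + share col y j t) + (jump a b + dist x y) ∎
    where
    open ℕ.≤-Reasoning
    i = ⌊ c ≟ j ⌋
    ring : ∀ a b c d → (a + b) + (c + d) ≡ (a + c) + (b + d)
    ring = solve-∀
    one-bead : 𝟙 (i ∧ ⌊ a ≟ t ⌋) ≤ 𝟙 (i ∧ ⌊ b ≟ t ⌋) + jump a b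
    one-bead with a ≟ b
    ... | yes refl = ℕ.m≤m+n _ _
    ... | no _     = ℕ.≤-trans (𝟙≤1 (i ∧ ⌊ a ≟ t ⌋)) (ℕ.m≤n+m 1 _)

  share-map : ∀ {m q n} {f : Fin q → Fin q} → (∀ {a b} → f a ≡ f b → a ≡ b) →
              ∀ (col : Vec (Fin m) n) (x : Vec (Fin q) n) j t → share col (Vec.map f x) j (f t) ≡ share col x j t
  share-map inj []        []      j t = refl
  share-map {f = f} inj (c ∷ col) (a ∷ x) j t = cong₂ _+_
    (cong (λ b → 𝟙 (⌊ c ≟ j ⌋ ∧ b)) (⌊⌋-⇔ (f a ≟ f t) (a ≟ t) inj (cong f)))
    (share-map inj col x j t)

  sum-zero : ∀ n → sum {n} (λ _ → 0) ≡ 0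
  sum-zero n = trans (sum-const n 0) (ℕ.*-zeroʳ n)

  sum-≟ : ∀ {n} (u : Fin n) → sum (λ t → 𝟙 ⌊ u ≟ t ⌋) ≡ 1
  sum-≟ {suc n} zero    = cong suc (sum-zero n)
  sum-≟ {suc n} (suc u) = trans (sum-cong-≗ λ t → cong 𝟙 (⌊⌋-⇔ (suc u ≟ suc t) (u ≟ t) Fin.suc-injective (cong suc))) (sum-≟ u)

  sum-∧-≟ : ∀ {n} b (u : Fin n) → sum (λ t → 𝟙 (b ∧ ⌊ u ≟ t ⌋)) ≡ 𝟙 b
  sum-∧-≟ true  u = sum-≟ u
  sum-∧-≟ {n} false u = sum-zero n

  sum-share : ∀ {m q n} (col : Vec (Fin m) n) (x : Vec (Fin q) n) j → sum (share col x j) ≡ beads col j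
  sum-share {q = q} [] []      j = sum-zero q
  sum-share (c ∷ col) (a ∷ x) j =
    trans (∑-distrib-+ (λ t → 𝟙 (⌊ c ≟ j ⌋ ∧ ⌊ a ≟ t ⌋)) (share col x j))
          (cong₂ _+_ (sum-∧-≟ ⌊ c ≟ j ⌋ a) (sum-share col x j))

  argmax : ∀ {n} → Fin n → (f : Fin n → ℕ) → ∃ λ i → ∀ j → f j ≤ f i
  argmax {suc zero}    _ f = zero , λ { zero → ℕ.≤-refl }
  argmax {suc (suc n)} _ f with argmax zero (f ∘ suc)
  ... | i , max with f zero ℕ.≤? f (suc i)
  ...   | yes f0≤ = suc i , λ { zero → f0≤ ; (suc j) → max j }
  ...   | no  f0≰ = zero , λ { zero → ℕ.≤-refl ; (suc j) → ℕ.≤-trans (max j) (ℕ.≰⇒≥ f0≰) }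

  -- The index argument only refutes the absence of a splitting; searching the finitely many words
  -- turns the refutation into a witness.
  any-word? : ∀ {q n} {P : Vec (Fin q) n → Set} → (∀ x → Dec (P x)) → Dec (∃ P)
  any-word? {n = zero}  P? = map′ ([] ,_) (λ { ([] , p) → p }) (P? [])
  any-word? {n = suc n} P? = map′ (λ { (a , x , p) → a ∷ x , p }) (λ { (a ∷ x , p) → a , x , p })
    (Fin.any? λ a → any-word? λ x → P? (a ∷ x))

  fold-vec-map : ∀ {A : Set} {n} (f : A → A) p → (∀ a → fold a f p ≡ a) → ∀ (x : Vec A n) → fold x (Vec.map f) p ≡ x
  fold-vec-map f p e []      = fold-[] p
    where
    fold-[] : ∀ p → fold [] (Vec.map f) p ≡ []
    fold-[] zero    = refl
    fold-[] (suc p) = cong (Vec.map f) (fold-[] p)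
  fold-vec-map f p e (a ∷ x) = trans (fold-∷ p) (cong₂ _∷_ (e a) (fold-vec-map f p e x))
    where
    fold-∷ : ∀ p → fold (a ∷ x) (Vec.map f) p ≡ fold a f p ∷ fold x (Vec.map f) p
    fold-∷ zero    = refl
    fold-∷ (suc p) = cong (Vec.map f) (fold-∷ p)

  -- A prime number of thieves

  module PrimeSplitting (p : ℕ) .{{_ : NonZero p}} (prime : Prime p) {m′ L : ℕ} (col : Vec (Fin (suc m′)) L) where

    open Rotation p
    open Selection p prime
    open Contraction (0 mod p) L
    open Cluster

    m n : ℕ
    m = suc m′
    n = (p ∸ 1) * m

    -- The error 2 p n pays for two comparisons of words at distance at most n, each moving p times
    -- a share by at most p n.
    Almost : Word → Set
    Almost x = changes x ≤ n × (∀ j t → p * share col x j t ≤ beads col j + 2 * (p * n))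

    almost? : ∀ x → Dec (Almost x)
    almost? x = (changes x ℕ.≤? n) ×-dec
      Fin.all? λ j → Fin.all? λ t → p * share col x j t ℕ.≤? beads col j + 2 * (p * n)

    -- This is p times the share minus the number of beads, shifted by the common constant L to stay
    -- in ℕ; subtracting the beads makes different colours comparable.
    excess : Word → Fin m → Fin p → ℕ
    excess x j t = p * share col x j t + (L ∸ beads col j)

    excess-dist : ∀ x y j t → excess x j t ≤ excess y j t + p * dist x y
    excess-dist x y j t = begin
      p * share col x j t + d              ≤⟨ ℕ.+-monoˡ-≤ d (ℕ.*-monoʳ-≤ p (share-dist col x y j t)) ⟩
      p * (share col y j t + dist x y) + d ≡⟨ ring p (share col y j t) (dist x y) d ⟩
      p * share col y j t + d + p * dist x y ∎
      where
      open ℕ.≤-Reasoning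
      d = L ∸ beads col j
      ring : ∀ p s e d → p * (s + e) + d ≡ p * s + d + p * e
      ring = solve-∀

    IsMax : Word → Fin m → Fin p → Set
    IsMax x j t = ∀ j′ t′ → excess x j′ t′ ≤ excess x j t

    isMax? : ∀ x j t → Dec (IsMax x j t)
    isMax? x j t = Fin.all? λ j′ → Fin.all? λ t′ → excess x j′ t′ ℕ.≤? excess x j t

    max : ∀ x → ∃ λ j → ∃ λ t → IsMax x j t
    max x =
      let best j = argmax (0 mod p) (excess x j)
          j , j-max = argmax zero (λ j → excess x j (proj₁ (best j)))
      in  j , proj₁ (best j) , λ j′ t′ → ℕ.≤-trans (proj₂ (best j′) t′) (j-max j′)

    unlucky : ∀ (x : Word) j → ∃ λ t → p * share col x j t ≤ beads col j
    unlucky x j with Fin.any? (λ t → p * share col x j t ℕ.≤? beads col j)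
    ... | yes t = t
    ... | no ¬t = contradiction (begin
      p * suc (beads col j)             ≡⟨ sum-const p (suc (beads col j)) ⟨
      sum {p} (λ _ → suc (beads col j)) ≤⟨ sum-mono (λ t → ℕ.≰⇒> λ le → ¬t (t , le)) ⟩
      sum (λ t → p * share col x j t)   ≡⟨ *-distribˡ-sum p (share col x j) ⟨
      p * sum (share col x j)           ≡⟨ cong (p *_) (sum-share col x j) ⟩
      p * beads col j                   ∎) (ℕ.<⇒≱ (ℕ.*-monoʳ-< p (ℕ.n<1+n _)))
      where open ℕ.≤-Reasoning

    Λ : List Word → Fin m → Fin p → Bool
    Λ S j t = ⌊ any? (λ x → isMax? x j t) S ⌋

    -- If every thief is the luckiest one for colour j somewhere in a cluster, then throughout the cluster the shares of
    -- colour j, hence all largest excesses, are nearly balanced.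
    full⇒almost : ∀ {k S} → k ≤ n → Cluster k S → ∀ j → (∀ t → Λ S j t ≡ true) → ∃ Almost
    full⇒almost {k} {S} k≤n c j full = x , ℕ.≤-trans (few-cuts c x∈) k≤n , bound
      where
      x = proj₁ (inhabited c)
      x∈ = proj₂ (inhabited c)
      t = proj₁ (unlucky x j)
      witness = find (⌊⌋-elim (any? (λ x → isMax? x j t) S) (full t))
      y = proj₁ witness
      near : ∀ {u v} → u ∈ S → v ∈ S → p * dist u v ≤ p * n
      near u∈ v∈ = ℕ.*-monoʳ-≤ p (ℕ.≤-trans (close c u∈ v∈) k≤n)
      bound : ∀ j′ t′ → p * share col x j′ t′ ≤ beads col j′ + 2 * (p * n)
      bound j′ t′ = ℕ.+-cancelʳ-≤ (L ∸ beads col j′) _ _ (begin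
        excess x j′ t′
          ≤⟨ excess-dist x y j′ t′ ⟩
        excess y j′ t′ + p * dist x y
          ≤⟨ ℕ.+-mono-≤ (proj₂ (proj₂ witness) j′ t′) (near x∈ (proj₁ (proj₂ witness))) ⟩
        excess y j t + p * n
          ≤⟨ ℕ.+-monoˡ-≤ (p * n) (ℕ.≤-trans (excess-dist y x j t)
               (ℕ.+-mono-≤ (ℕ.+-monoˡ-≤ (L ∸ beads col j) (proj₂ (unlucky x j))) (near (proj₁ (proj₂ witness)) x∈))) ⟩
        beads col j + (L ∸ beads col j) + p * n + p * n
          ≡⟨ cong (λ z → z + p * n + p * n) (trans (total j) (sym (total j′))) ⟩
        beads col j′ + (L ∸ beads col j′) + p * n + p * n
          ≡⟨ ring (beads col j′) (L ∸ beads col j′) (p * n) ⟩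
        beads col j′ + 2 * (p * n) + (L ∸ beads col j′) ∎)
        where
        open ℕ.≤-Reasoning
        total : ∀ j → beads col j + (L ∸ beads col j) ≡ L
        total j = ℕ.m+[n∸m]≡n (count≤ _ col)
        ring : ∀ a b e → a + b + e + e ≡ a + 2 * e + b
        ring = solve-∀

    Λ-nonempty : ∀ {k S} → Cluster k S → ∃ λ j → 0 < size (Λ S j)
    Λ-nonempty {S = S} c =
      let x , x∈ = inhabited c
          j , t , x-max = max x
      in  j , size-pos (Λ S j) {t} (⌊⌋-intro (any? (λ x → isMax? x j t) S) (lose x∈ x-max))

    Λ-mono : ∀ {S S′} → S ⊆ S′ → ∀ j t → 𝟙 (Λ S j t) ≤ 𝟙 (Λ S′ j t)
    Λ-mono {S} {S′} S⊆S′ j t with any? (λ x → isMax? x j t) S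
    ... | no _  = z≤n
    ... | yes a = let x , x∈ , x-max = find a in
      ℕ.≤-reflexive (sym (cong 𝟙 (⌊⌋-intro (any? (λ x → isMax? x j t) S′) (lose (S⊆S′ x∈) x-max))))

    rotʷ : Word → Word
    rotʷ = Vec.map rot

    ρ : List Word → List Word
    ρ = List.map rotʷ

    ρᵖ≗id : ∀ S → fold S ρ p ≡ S
    ρᵖ≗id = fold-map-period rotʷ p (fold-vec-map rot p rotᵖ≗id)

    excess-rot : ∀ x j t → excess (rotʷ x) j (rot t) ≡ excess x j t
    excess-rot x j t = cong (λ z → p * z + (L ∸ beads col j)) (share-map rot-injective col x j t)

    isMax-rot⁺ : ∀ x j t → IsMax x j t → IsMax (rotʷ x) j (rot t)
    isMax-rot⁺ x j t x-max j′ t′ = subst (λ u → excess (rotʷ x) j′ u ≤ excess (rotʷ x) j (rot t)) (rot∘unrot t′)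
      (subst₂ _≤_ (sym (excess-rot x j′ (unrot t′))) (sym (excess-rot x j t)) (x-max j′ (unrot t′)))

    isMax-rot⁻ : ∀ x j t → IsMax (rotʷ x) j (rot t) → IsMax x j t
    isMax-rot⁻ x j t x-max j′ t′ = subst₂ _≤_ (excess-rot x j′ t′) (excess-rot x j t) (x-max j′ (rot t′))

    Λ-rot : ∀ S j t → Λ (ρ S) j (rot t) ≡ Λ S j t
    Λ-rot S j t = ⌊⌋-⇔ (any? (λ x → isMax? x j (rot t)) (ρ S)) (any? (λ x → isMax? x j t) S)
      (λ a → let y , y∈ , y-max = find a
                 x , x∈ , y≡ = ∈-map⁻ rotʷ y∈
             in  lose x∈ (isMax-rot⁻ x j t (subst (λ y → IsMax y j (rot t)) y≡ y-max)))
      (λ a → let x , x∈ , x-max = find a in lose (∈-map⁺ rotʷ x∈) (isMax-rot⁺ x j t x-max))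

    Cluster-ρ : ∀ {k S} → Cluster k S → Cluster k (ρ S)
    Cluster-ρ {k} {S} c = cluster (_ , ∈-map⁺ rotʷ (proj₂ (inhabited c))) few cl
      where
      few : ∀ {x} → x ∈ ρ S → changes x ≤ k
      few m with x , x∈ , refl ← ∈-map⁻ rotʷ m = subst (_≤ k) (sym (changes-map rot-injective x)) (few-cuts c x∈)
      cl : ∀ {x y} → x ∈ ρ S → y ∈ ρ S → dist x y ≤ k
      cl m m′ with x , x∈ , refl ← ∈-map⁻ rotʷ m | y , y∈ , refl ← ∈-map⁻ rotʷ m′ =
        subst (_≤ k) (sym (dist-map rot-injective x y)) (close c x∈ y∈)

    Good-ρ : ∀ {k l} → Good k l → Good k (List.map ρ l)
    Good-ρ {l = l} (len , lk , cs) =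
      trans (List.length-map ρ l) len ,
      Linked.map⁺ (Linked.map (Subset.map⁺ rotʷ) lk) ,
      All.map⁺ (All.map Cluster-ρ cs)

    label : List Word → Fin p
    label S = select (Λ S)

    total : List Word → ℕ
    total S = sum λ j → size (Λ S j)

    module _ {S S′ : List Word} (S⊆S′ : S ⊆ S′) (total≥ : total S′ ≤ total S) where

      label-stable : label S ≡ label S′
      label-stable = select-cong λ j t → 𝟙-injective (sum≡⇒≗ (Λ-mono S⊆S′ j) (ℕ.≤-reflexive (sym (sizes j))) t)
        where
        sizes : ∀ j → size (Λ S j) ≡ size (Λ S′ j)
        sizes = sum≡⇒≗ (λ j → sum-mono (Λ-mono S⊆S′ j)) total≥
        𝟙-injective : ∀ {b c} → 𝟙 b ≡ 𝟙 c → b ≡ c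
        𝟙-injective {true}  {true}  _ = refl
        𝟙-injective {false} {false} _ = refl

    climb : ∀ {S l} → All (λ S → total S ≤ n) (S ∷ l) → Linked _⊆_ (S ∷ l) →
            Dup (List.map label (S ∷ l)) ⊎ total S + length l ≤ n
    climb {S} {[]}     (b ∷ _)  _         = inj₂ (subst (_≤ n) (sym (ℕ.+-identityʳ (total S))) b)
    climb {S} {S′ ∷ l} (_ ∷ bs) (r ∷ lk) with climb bs lk
    ... | inj₁ d = inj₁ (there d)
    ... | inj₂ le with total S′ ℕ.≤? total S
    ...   | yes ≥ = inj₁ (subst (λ a → Dup (label S ∷ a ∷ List.map label l)) (label-stable r ≥) here)
    ...   | no ≱  = inj₂ (ℕ.≤-trans (ℕ.≤-reflexive (ℕ.+-suc (total S) (length l)))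
                                 (ℕ.≤-trans (ℕ.+-monoˡ-≤ (length l) (ℕ.≰⇒> ≱)) le))

    module _ (¬a : ¬ ∃ Almost) where

      1<p : 1 < p
      1<p = ℕ.nonTrivial⇒n>1 p {{prime⇒nonTrivial prime}}

      proper : ∀ {k S} → k ≤ n → Cluster k S → ∀ j → size (Λ S j) < p
      proper {S = S} k≤n c j = ℕ.≰⇒> λ p≤ → ¬a (full⇒almost k≤n c j (size-full (Λ S j) p≤))

      label-ρ : ∀ {k l} → k ≤ n → Good k l → List.map label (List.map ρ l) ≡ List.map rot (List.map label l)
      label-ρ k≤n (_ , _ , cs) = go cs
        where
        go : ∀ {l} → All (Cluster _) l → List.map label (List.map ρ l) ≡ List.map rot (List.map label l)
        go []       = refl
        go {S ∷ _} (c ∷ cs) = cong₂ _∷_ (select-rot (Λ-rot S) (Λ-nonempty c) (proper k≤n c)) (go cs)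

      total≤n : ∀ {S} → Cluster n S → total S ≤ n
      total≤n {S} c = begin
        total S               ≤⟨ sum-mono (λ j → ℕ.<⇒≤pred (proper ℕ.≤-refl c j)) ⟩
        sum {m} (λ _ → p ∸ 1) ≡⟨ sum-const m (p ∸ 1) ⟩
        m * (p ∸ 1)           ≡⟨ ℕ.*-comm m (p ∸ 1) ⟩
        n                     ∎
        where open ℕ.≤-Reasoning

      degenerate : ∀ {l} → Good n l → Dup (List.map label l)
      degenerate {S ∷ l} (len , lk , c ∷ cs) = [ id , (λ le → contradiction (too-many le) ℕ.1+n≰n) ]′
        (climb (All.map total≤n (c ∷ cs)) lk)
        where
        open ℕ.≤-Reasoning
        too-many : total S + length l ≤ n → suc n ≤ n
        -- The initial label set already has one element, and each of the n steps adds another.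
        too-many le = begin
          suc n              ≡⟨ len ⟨
          1 + length l       ≤⟨ ℕ.+-monoˡ-≤ (length l) (ℕ.≤-trans (proj₂ (Λ-nonempty c))
                               (≤-sum (λ j → size (Λ S j)) (proj₁ (Λ-nonempty c)))) ⟩
          total S + length l ≤⟨ le ⟩
          n                  ∎

      absurd : Empty.⊥
      absurd = Index.¬all-degenerate p 1<p ρ ρᵖ≗id (o* ∷ []) (o* ∷ []) D D-linear D-normal D-homotopy Good proj₁
        (refl , [-] , cluster-≤ ∷ []) Good-ρ D-vanish label n label-ρ degenerate

    almost-fair : ∃ Almost
    almost-fair = decidable-stable (any-word? almost?) absurd

  -- The error E is fixed before the necklace, so it may depend on m but not on the length. Only
  -- upper bounds are kept: they are what Hall's condition consumes, and they compose.
  AlmostFair : ℕ → Set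
  AlmostFair q = ∀ m → ∃ λ E → ∀ {L} (col : Vec (Fin m) L) → ∃ λ (x : Vec (Fin q) L) →
    changes x ≤ (q ∸ 1) * m × (∀ j t → q * share col x j t ≤ beads col j + E)

  share≤beads : ∀ {m q L} (col : Vec (Fin m) L) (x : Vec (Fin q) L) j t → share col x j t ≤ beads col j
  share≤beads []        []      j t = z≤n
  share≤beads (c ∷ col) (a ∷ x) j t = ℕ.+-mono-≤ (∧≤ ⌊ c ≟ j ⌋) (share≤beads col x j t)
    where
    ∧≤ : ∀ b → 𝟙 (b ∧ ⌊ a ≟ t ⌋) ≤ 𝟙 b
    ∧≤ true  = 𝟙≤1 ⌊ a ≟ t ⌋
    ∧≤ false = z≤n

  almostFair-1 : AlmostFair 1
  almostFair-1 m = 0 , λ {L} col → Vec.replicate L zero ,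
    ℕ.≤-reflexive (changes-replicate L zero) ,
    λ j t → ℕ.+-mono-≤ (share≤beads col (Vec.replicate L zero) j t) z≤n

  almostFair-prime : ∀ {p} → Prime p → AlmostFair p
  -- Without colours there are no labels to select from, so this case stands apart.
  almostFair-prime {p} pr zero    = 0 , λ {L} col → Vec.replicate L (0 mod p) ,
    ℕ.≤-trans (ℕ.≤-reflexive (changes-replicate L (0 mod p))) z≤n , λ ()
    where instance _ = prime⇒nonZero pr
  almostFair-prime {p} pr (suc m) = 2 * (p * ((p ∸ 1) * suc m)) , λ col → PrimeSplitting.almost-fair p pr col
    where instance _ = prime⇒nonZero pr

  -- Composition in the number of thieves

  ⌊⌋-×-dec : ∀ {P Q : Set} (d : Dec P) (e : Dec Q) → ⌊ d ⌋ ∧ ⌊ e ⌋ ≡ ⌊ d ×-dec e ⌋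
  ⌊⌋-×-dec (yes _) (yes _) = refl
  ⌊⌋-×-dec (yes _) (no _)  = refl
  ⌊⌋-×-dec (no _)  _       = refl

  combine-≟ : ∀ {m n} (i k : Fin m) (j l : Fin n) → ⌊ combine i j ≟ combine k l ⌋ ≡ ⌊ i ≟ k ⌋ ∧ ⌊ j ≟ l ⌋
  combine-≟ i k j l = trans
    (⌊⌋-⇔ (combine i j ≟ combine k l) (i ≟ k ×-dec j ≟ l)
      (Fin.combine-injective i j k l) (λ { (refl , refl) → refl }))
    (sym (⌊⌋-×-dec (i ≟ k) (j ≟ l)))

  module _ {q r : ℕ} where

    jump-combine : ∀ (a a′ : Fin q) (b b′ : Fin r) → jump (combine a b) (combine a′ b′) ≤ jump a a′ + jump b b′
    jump-combine a a′ b b′ rewrite combine-≟ a a′ b b′ = lemma ⌊ a ≟ a′ ⌋ ⌊ b ≟ b′ ⌋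
      where
      lemma : ∀ u v → 𝟙 (not (u ∧ v)) ≤ 𝟙 (not u) + 𝟙 (not v)
      lemma true  v = ℕ.≤-refl
      lemma false v = s≤s z≤n

    changes-combine : ∀ {L} (x : Vec (Fin q) L) (y : Vec (Fin r) L) →
                      changes (Vec.zipWith combine x y) ≤ changes x + changes y
    changes-combine []           []           = z≤n
    changes-combine (a ∷ [])     (b ∷ [])     = z≤n
    changes-combine (a ∷ a′ ∷ x) (b ∷ b′ ∷ y) = begin
      jump (combine a b) (combine a′ b′) + changes (Vec.zipWith combine (a′ ∷ x) (b′ ∷ y))
        ≤⟨ ℕ.+-mono-≤ (jump-combine a a′ b b′) (changes-combine (a′ ∷ x) (b′ ∷ y)) ⟩
      (jump a a′ + jump b b′) + (changes (a′ ∷ x) + changes (b′ ∷ y))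
        ≡⟨ ring (jump a a′) (jump b b′) (changes (a′ ∷ x)) (changes (b′ ∷ y)) ⟩
      changes (a ∷ a′ ∷ x) + changes (b ∷ b′ ∷ y) ∎
      where
      open ℕ.≤-Reasoning
      ring : ∀ a b c d → (a + b) + (c + d) ≡ (a + c) + (b + d)
      ring = solve-∀

    module _ {m : ℕ} where

      beads-combine : ∀ {L} (col : Vec (Fin m) L) (x : Vec (Fin q) L) t j →
                      beads (Vec.zipWith combine x col) (combine t j) ≡ share col x j t
      beads-combine []        []      t j = refl
      beads-combine (c ∷ col) (a ∷ x) t j = cong₂ _+_
        (cong 𝟙 (trans (combine-≟ a t c j) (∧-comm ⌊ a ≟ t ⌋ ⌊ c ≟ j ⌋)))
        (beads-combine col x t j)

      share-combine : ∀ {L} (col : Vec (Fin m) L) (x : Vec (Fin q) L) (y : Vec (Fin r) L) (t : Fin q) (u : Fin r) j →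
                      share (Vec.zipWith combine x col) y (combine t j) u ≡ share col (Vec.zipWith combine x y) j (combine t u)
      share-combine []        []      []      t u j = refl
      share-combine (c ∷ col) (a ∷ x) (b ∷ y) t u j = cong₂ _+_
        (cong 𝟙 (begin
          ⌊ combine a c ≟ combine t j ⌋ ∧ ⌊ b ≟ u ⌋   ≡⟨ cong (_∧ ⌊ b ≟ u ⌋) (combine-≟ a t c j) ⟩
          (⌊ a ≟ t ⌋ ∧ ⌊ c ≟ j ⌋) ∧ ⌊ b ≟ u ⌋         ≡⟨ cong (_∧ ⌊ b ≟ u ⌋) (∧-comm ⌊ a ≟ t ⌋ ⌊ c ≟ j ⌋) ⟩
          (⌊ c ≟ j ⌋ ∧ ⌊ a ≟ t ⌋) ∧ ⌊ b ≟ u ⌋         ≡⟨ ∧-assoc ⌊ c ≟ j ⌋ ⌊ a ≟ t ⌋ ⌊ b ≟ u ⌋ ⟩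
          ⌊ c ≟ j ⌋ ∧ (⌊ a ≟ t ⌋ ∧ ⌊ b ≟ u ⌋)         ≡⟨ cong (⌊ c ≟ j ⌋ ∧_) (combine-≟ a t b u) ⟨
          ⌊ c ≟ j ⌋ ∧ ⌊ combine a b ≟ combine t u ⌋   ∎))
        (share-combine col x y t u j)
        where open ≡-Reasoning

  -- The beads of the q parts are told apart by colours in [q] × [m], so that one splitting of the recoloured necklace among r
  -- thieves splits all q parts at once.
  almostFair-* : ∀ {q r} .{{_ : NonZero q}} .{{_ : NonZero r}} → AlmostFair q → AlmostFair r → AlmostFair (q * r)
  almostFair-* {q} {r} Q R m = E₁ + q * E₂ , λ col →
    let x , x-cuts , x-fair = proj₂ (Q m) col
        y , y-cuts , y-fair = proj₂ (R (q * m)) (Vec.zipWith combine x col)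
        open ℕ.≤-Reasoning

        fair : ∀ j (t : Fin q) (u : Fin r) → q * r * share col (Vec.zipWith combine x y) j (combine t u) ≤ beads col j + (E₁ + q * E₂)
        fair j t u = begin
          q * r * share col (Vec.zipWith combine x y) j (combine t u)
            ≡⟨ cong (q * r *_) (share-combine col x y t u j) ⟨
          q * r * share (Vec.zipWith combine x col) y (combine t j) u
            ≡⟨ ℕ.*-assoc q r _ ⟩
          q * (r * share (Vec.zipWith combine x col) y (combine t j) u)
            ≤⟨ ℕ.*-monoʳ-≤ q (y-fair (combine t j) u) ⟩
          q * (beads (Vec.zipWith combine x col) (combine t j) + E₂)
            ≡⟨ cong (λ z → q * (z + E₂)) (beads-combine {r = r} col x t j) ⟩
          q * (share col x j t + E₂)
            ≡⟨ ℕ.*-distribˡ-+ q (share col x j t) E₂ ⟩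
          q * share col x j t + q * E₂
            ≤⟨ ℕ.+-monoˡ-≤ (q * E₂) (x-fair j t) ⟩
          beads col j + E₁ + q * E₂
            ≡⟨ ℕ.+-assoc (beads col j) E₁ (q * E₂) ⟩
          beads col j + (E₁ + q * E₂) ∎
    in Vec.zipWith combine x y ,
       (begin
         changes (Vec.zipWith combine x y)       ≤⟨ changes-combine x y ⟩
         changes x + changes y                   ≤⟨ ℕ.+-mono-≤ x-cuts y-cuts ⟩
         (q ∸ 1) * m + (r ∸ 1) * (q * m)         ≡⟨ cuts q r ⟩
         (q * r ∸ 1) * m                         ∎) ,
       λ j T → let t , u , eq = Fin.combine-surjective T in
         subst (λ T → q * r * share col (Vec.zipWith combine x y) j T ≤ beads col j + (E₁ + q * E₂)) eq (fair j t u)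
    where
    E₁ = proj₁ (Q m)
    E₂ = proj₁ (R (q * m))
    -- The second splitting sees q m colours; with this many the two bounds add up without loss.
    cuts : ∀ q r .{{_ : NonZero q}} .{{_ : NonZero r}} → (q ∸ 1) * m + (r ∸ 1) * (q * m) ≡ (q * r ∸ 1) * m
    cuts (suc q) (suc r) = ring q r m
      where
      ring : ∀ q r m → q * m + r * (m + q * m) ≡ (r + q * (1 + r)) * m
      ring = solve-∀

  almostFair-product : ∀ {ps} → All Prime ps → NonZero (product ps) × AlmostFair (product ps)
  almostFair-product []         = _ , almostFair-1
  almostFair-product {p ∷ ps} (pr ∷ prs) = ℕ.m*n≢0 p (product ps) , almostFair-* (almostFair-prime pr) rest
    where
    rest = proj₂ (almostFair-product prs)
    instance
      _ = prime⇒nonZero pr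
      _ = proj₁ (almostFair-product prs)

  almostFair : ∀ q .{{_ : NonZero q}} → AlmostFair q
  almostFair q = subst AlmostFair (sym isFactorisation) (proj₂ (almostFair-product factorsPrime))
    where open PrimeFactorisation (factorise q)

-- Rounding

open import Data.Nat using (_+_; _*_)
open import Data.Nat.Tactic.RingSolver using (solve-∀)
open import Data.Fin.Subset using (Subset; _∈_; _∉_; _⊆_; _∪_; _∩_; ⊥; ⁅_⁆; ∣_∣; inside; outside)
open import Data.Fin.Subset.Properties using (drop-there; _∈?_; _⊆?_; anySubset?; ∉⊥; x∈⁅x⁆; x∈⁅y⁆⇒x≡y;
  x∈p∪q⁻; x∈p∩q⁺; x∈p∩q⁻; p⊆p∪q; q⊆p∪q)

sum-submodular : ∀ {n} {f g f′ g′ : Fin n → ℕ} → (∀ i → f i + g i ≤ f′ i + g′ i) → sum f + sum g ≤ sum f′ + sum g′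
sum-submodular {f = f} {g} {f′} {g′} e = subst₂ _≤_ (∑-distrib-+ f g) (∑-distrib-+ f′ g′) (sum-mono e)

-- Hall's theorem with capacities

capacity : ∀ {q} → Subset q → (Fin q → ℕ) → ℕ
capacity S κ = sum λ t → 𝟙 ⌊ t ∈? S ⌋ * κ t

module _ {q : ℕ} (κ : Fin q → ℕ) where

  capacity-modular : ∀ S S′ → capacity (S ∪ S′) κ + capacity (S ∩ S′) κ ≤ capacity S κ + capacity S′ κ
  capacity-modular S S′ = sum-submodular λ t →
    subst₂ _≤_ (ℕ.*-distribʳ-+ (κ t) (𝟙 ⌊ t ∈? S ∪ S′ ⌋) (𝟙 ⌊ t ∈? S ∩ S′ ⌋))
               (ℕ.*-distribʳ-+ (κ t) (𝟙 ⌊ t ∈? S ⌋) (𝟙 ⌊ t ∈? S′ ⌋))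
               (ℕ.*-monoˡ-≤ (κ t) (pointwise t))
    where
    pointwise : ∀ t → 𝟙 ⌊ t ∈? S ∪ S′ ⌋ + 𝟙 ⌊ t ∈? S ∩ S′ ⌋ ≤ 𝟙 ⌊ t ∈? S ⌋ + 𝟙 ⌊ t ∈? S′ ⌋
    pointwise t with t ∈? S | t ∈? S′ | t ∈? S ∪ S′ | t ∈? S ∩ S′
    ... | yes _ | yes _ | a     | b     = ℕ.+-mono-≤ (𝟙≤1 ⌊ a ⌋) (𝟙≤1 ⌊ b ⌋)
    ... | yes _ | no n  | _     | yes i = contradiction (proj₂ (x∈p∩q⁻ S S′ i)) n
    ... | no n  | _     | _     | yes i = contradiction (proj₁ (x∈p∩q⁻ S S′ i)) n
    ... | yes _ | no _  | a     | no _  = ℕ.+-monoˡ-≤ 0 (𝟙≤1 ⌊ a ⌋)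
    ... | no _  | yes _ | a     | no _  = ℕ.≤-trans (ℕ.≤-reflexive (ℕ.+-identityʳ _)) (𝟙≤1 ⌊ a ⌋)
    ... | no _  | no _  | no _  | no _  = z≤n
    ... | no n  | no n′ | yes u | no _  with x∈p∪q⁻ S S′ u
    ...   | inj₁ t∈ = contradiction t∈ n
    ...   | inj₂ t∈ = contradiction t∈ n′

  capacity-⊥ : capacity ⊥ κ ≤ 0
  capacity-⊥ = ℕ.≤-trans (sum-mono λ t → none t) (ℕ.≤-reflexive (trans (sum-const q 0) (ℕ.*-zeroʳ q)))
    where
    none : ∀ t → 𝟙 ⌊ t ∈? ⊥ ⌋ * κ t ≤ 0
    none t with t ∈? ⊥
    ... | yes t∈ = contradiction t∈ ∉⊥
    ... | no _   = z≤n

  capacity-⁅⁆ : ∀ t → κ t ≡ 0 → capacity ⁅ t ⁆ κ ≤ 0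
  capacity-⁅⁆ t κt≡0 = ℕ.≤-trans (sum-mono none) (ℕ.≤-reflexive (trans (sum-const q 0) (ℕ.*-zeroʳ q)))
    where
    none : ∀ u → 𝟙 ⌊ u ∈? ⁅ t ⁆ ⌋ * κ u ≤ 0
    none u with u ∈? ⁅ t ⁆
    ... | no _   = z≤n
    ... | yes u∈ rewrite x∈⁅y⁆⇒x≡y t u∈ | κt≡0 = z≤n

  remove : Fin q → Fin q → ℕ
  remove t u = κ u ∸ 𝟙 ⌊ t ≟ u ⌋

  capacity-remove : ∀ t S → capacity S κ ≤ capacity S (remove t) + 𝟙 ⌊ t ∈? S ⌋
  capacity-remove t S = begin
    capacity S κ
      ≤⟨ sum-mono step ⟩
    sum (λ u → 𝟙 ⌊ u ∈? S ⌋ * remove t u + 𝟙 (⌊ t ∈? S ⌋ ∧ ⌊ t ≟ u ⌋))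
      ≡⟨ ∑-distrib-+ (λ u → 𝟙 ⌊ u ∈? S ⌋ * remove t u) (λ u → 𝟙 (⌊ t ∈? S ⌋ ∧ ⌊ t ≟ u ⌋)) ⟩
    capacity S (remove t) + sum (λ u → 𝟙 (⌊ t ∈? S ⌋ ∧ ⌊ t ≟ u ⌋))
      ≡⟨ cong (capacity S (remove t) +_) (sum-∧-≟ ⌊ t ∈? S ⌋ t) ⟩
    capacity S (remove t) + 𝟙 ⌊ t ∈? S ⌋ ∎
    where
    open ℕ.≤-Reasoning
    step : ∀ u → 𝟙 ⌊ u ∈? S ⌋ * κ u ≤ 𝟙 ⌊ u ∈? S ⌋ * remove t u + 𝟙 (⌊ t ∈? S ⌋ ∧ ⌊ t ≟ u ⌋)
    step u with u ∈? S | t ≟ u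
    ... | no _   | _        = z≤n
    ... | yes _  | no _     = ℕ.m≤m+n _ _
    ... | yes u∈ | yes refl rewrite ⌊⌋-intro (t ∈? S) u∈ | ℕ.+-identityʳ (κ t)
                                  | ℕ.+-identityʳ (κ t ∸ 1) | ℕ.+-comm (κ t ∸ 1) 1 =
      ℕ.m≤n+m∸n (κ t) 1

module _ {q : ℕ} where

  -- Hall's condition is stated through sets of thieves rather than sets of beads: the demand is
  -- then supermodular and the capacity modular.
  demand : ∀ {n} → (Fin n → Bool) → (Fin n → Subset q) → Subset q → ℕ
  demand active allowed S = size λ i → active i ∧ ⌊ allowed i ⊆? S ⌋

  demand-supermodular : ∀ {n} active (allowed : Fin n → Subset q) S S′ →
    demand active allowed S + demand active allowed S′ ≤ demand active allowed (S ∪ S′) + demand active allowed (S ∩ S′)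
  demand-supermodular active allowed S S′ = sum-submodular λ i → pointwise (active i) (allowed i)
    where
    pointwise : ∀ b A → 𝟙 (b ∧ ⌊ A ⊆? S ⌋) + 𝟙 (b ∧ ⌊ A ⊆? S′ ⌋) ≤ 𝟙 (b ∧ ⌊ A ⊆? S ∪ S′ ⌋) + 𝟙 (b ∧ ⌊ A ⊆? S ∩ S′ ⌋)
    pointwise false A = z≤n
    pointwise true  A with A ⊆? S | A ⊆? S′ | A ⊆? S ∪ S′ | A ⊆? S ∩ S′
    ... | yes _ | yes _  | yes _ | yes _ = ℕ.≤-refl
    ... | yes a | yes a′ | _     | no n  = Empty.⊥-elim (n (λ x∈ → x∈p∩q⁺ (a x∈ , a′ x∈)))
    ... | yes a | _      | no n  | _     = Empty.⊥-elim (n (λ x∈ → p⊆p∪q S′ (a x∈)))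
    ... | _     | yes a′ | no n  | _     = Empty.⊥-elim (n (λ x∈ → q⊆p∪q S S′ (a′ x∈)))
    ... | yes _ | no _   | yes _ | _     = s≤s z≤n
    ... | no _  | yes _  | yes _ | _     = s≤s z≤n
    ... | no _  | no _   | _     | _     = z≤n

  module _ {n} (active : Fin n → Bool) (allowed : Fin n → Subset q) (κ : Fin q → ℕ)
           (feasible : ∀ S → demand active allowed S ≤ capacity S κ) where

    Tight : Subset q → Set
    Tight S = capacity S κ ≤ demand active allowed S

    -- The intersection cannot absorb more demand than its capacity, so what the two tight sets
    -- demand together must saturate the union.
    tight-∪ : ∀ {S S′} → Tight S → Tight S′ → Tight (S ∪ S′)
    tight-∪ {S} {S′} t t′ = ℕ.+-cancelʳ-≤ (capacity (S ∩ S′) κ) _ _ (begin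
      capacity (S ∪ S′) κ + capacity (S ∩ S′) κ
        ≤⟨ capacity-modular κ S S′ ⟩
      capacity S κ + capacity S′ κ
        ≤⟨ ℕ.+-mono-≤ t t′ ⟩
      demand active allowed S + demand active allowed S′
        ≤⟨ demand-supermodular active allowed S S′ ⟩
      demand active allowed (S ∪ S′) + demand active allowed (S ∩ S′)
        ≤⟨ ℕ.+-monoʳ-≤ _ (feasible (S ∩ S′)) ⟩
      demand active allowed (S ∪ S′) + capacity (S ∩ S′) κ ∎)
      where open ℕ.≤-Reasoning

    tight-⋃ : ∀ k (F : Fin k → Subset q) → (∀ i → Tight (F i)) → ∃ λ U → Tight U × (∀ i → F i ⊆ U)
    tight-⋃ zero    F t = ⊥ , ℕ.≤-trans (capacity-⊥ κ) z≤n , λ ()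
    tight-⋃ (suc k) F t with tight-⋃ k (F ∘ suc) (t ∘ suc)
    ... | U , tU , F⊆U = F zero ∪ U , tight-∪ {F zero} {U} (t zero) tU ,
      λ { zero → p⊆p∪q U ; (suc i) x∈ → q⊆p∪q (F zero) U (F⊆U i x∈) }

  -- If every thief t allowed for the first active bead is blocked by a tight set containing t, the union of these sets is
  -- tight and violates the condition.
  hall : Fin q → ∀ {n} (active : Fin n → Bool) (allowed : Fin n → Subset q) (κ : Fin q → ℕ) →
    (∀ S → demand active allowed S ≤ capacity S κ) →
    ∃ λ (c : Fin n → Fin q) →
      (∀ i → active i ≡ true → c i ∈ allowed i) × (∀ t → size (λ i → active i ∧ ⌊ c i ≟ t ⌋) ≤ κ t)
  hall o {zero}  active allowed κ h = (λ ()) , (λ ()) , λ t → z≤n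
  hall o {suc n} active allowed κ h with active zero in act
  ... | false with hall o (active ∘ suc) (allowed ∘ suc) κ h
  ...   | c , c∈ , load = (λ { zero → o ; (suc i) → c i }) ,
    (λ { zero a → contradiction (trans (sym act) a) (λ ()) ; (suc i) a → c∈ i a }) , load
  hall o {suc n} active allowed κ h | true = result
    where
    active′  = active ∘ suc
    allowed′ = allowed ∘ suc
    A = allowed zero

    Blocking : Fin q → Subset q → Set
    Blocking t S = capacity S κ < demand active′ allowed′ S + 𝟙 ⌊ t ∈? S ⌋

    blocking? : ∀ t → Dec (∃ (Blocking t))
    blocking? t = anySubset? λ S → capacity S κ ℕ.<? demand active′ allowed′ S + 𝟙 ⌊ t ∈? S ⌋

    h′ : ∀ S → demand active′ allowed′ S ≤ capacity S κ
    h′ S = ℕ.≤-trans (ℕ.m≤n+m _ _) (h S)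

    result : ∃ λ (c : Fin (suc n) → Fin q) →
      (∀ i → active i ≡ true → c i ∈ allowed i) ×
      (∀ t → 𝟙 ⌊ c zero ≟ t ⌋ + size (λ i → active′ i ∧ ⌊ c (suc i) ≟ t ⌋) ≤ κ t)
    result with Fin.any? (λ t → (t ∈? A) ×-dec ¬? (blocking? t))
    ... | yes (t , t∈A , ¬b) = extend (hall o active′ allowed′ (remove κ t) feasible)
      where
      free : ∀ S → demand active′ allowed′ S + 𝟙 ⌊ t ∈? S ⌋ ≤ capacity S κ
      free S = ℕ.≮⇒≥ λ lt → ¬b (S , lt)
      feasible : ∀ S → demand active′ allowed′ S ≤ capacity S (remove κ t)
      feasible S = ℕ.+-cancelʳ-≤ (𝟙 ⌊ t ∈? S ⌋) _ _ (ℕ.≤-trans (free S) (capacity-remove κ t S))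
      -- The subtraction in `remove` is truncated, so a free place at t has to be shown; the
      -- singleton of t, which does not block, provides it.
      κt≢0 : κ t ≢ 0
      κt≢0 κt≡0 = contradiction (begin
        1 ≡⟨ cong 𝟙 (⌊⌋-intro (t ∈? ⁅ t ⁆) (x∈⁅x⁆ t)) ⟨
        𝟙 ⌊ t ∈? ⁅ t ⁆ ⌋ ≤⟨ ℕ.m≤n+m _ (demand active′ allowed′ ⁅ t ⁆) ⟩
        demand active′ allowed′ ⁅ t ⁆ + 𝟙 ⌊ t ∈? ⁅ t ⁆ ⌋ ≤⟨ free ⁅ t ⁆ ⟩
        capacity ⁅ t ⁆ κ ≤⟨ capacity-⁅⁆ κ t κt≡0 ⟩
        0 ∎) λ ()
        where open ℕ.≤-Reasoning
      extend : (∃ λ (c : Fin n → Fin q) →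
        (∀ i → active′ i ≡ true → c i ∈ allowed′ i) × (∀ u → size (λ i → active′ i ∧ ⌊ c i ≟ u ⌋) ≤ remove κ t u)) → _
      extend (c , c∈ , load) = c⁺ , (λ { zero _ → t∈A ; (suc i) a → c∈ i a }) , load⁺
        where
        c⁺ : Fin (suc n) → Fin q
        c⁺ zero    = t
        c⁺ (suc i) = c i
        load⁺ : ∀ u → 𝟙 ⌊ t ≟ u ⌋ + size (λ i → active′ i ∧ ⌊ c i ≟ u ⌋) ≤ κ u
        load⁺ u = begin
          𝟙 ⌊ t ≟ u ⌋ + size (λ i → active′ i ∧ ⌊ c i ≟ u ⌋)
            ≤⟨ ℕ.+-monoʳ-≤ (𝟙 ⌊ t ≟ u ⌋) (load u) ⟩
          𝟙 ⌊ t ≟ u ⌋ + (κ u ∸ 𝟙 ⌊ t ≟ u ⌋)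
            ≡⟨ ℕ.m+[n∸m]≡n fits ⟩
          κ u ∎
          where
          open ℕ.≤-Reasoning
          fits : 𝟙 ⌊ t ≟ u ⌋ ≤ κ u
          fits with t ≟ u
          ... | no _     = z≤n
          ... | yes refl = ℕ.n≢0⇒n>0 κt≢0
    ... | no all-blocked = contradiction (begin
      suc (demand active′ allowed′ U)
        ≡⟨ cong (λ b → 𝟙 b + demand active′ allowed′ U) (⌊⌋-intro (A ⊆? U) A⊆U) ⟨
      𝟙 ⌊ A ⊆? U ⌋ + demand active′ allowed′ U
        ≤⟨ h U ⟩
      capacity U κ
        ≤⟨ tight-U ⟩
      demand active′ allowed′ U ∎) ℕ.1+n≰n
      where
      open ℕ.≤-Reasoning
      block : ∀ t → ∃ λ S → Tight active′ allowed′ κ h′ S × (t ∈ A → t ∈ S)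
      block t with t ∈? A
      -- The empty set is tight and fills the family at thieves who are not allowed.
      ... | no t∉A  = ⊥ , ℕ.≤-trans (capacity-⊥ κ) z≤n , λ t∈A → contradiction t∈A t∉A
      ... | yes t∈A with decidable-stable (blocking? t) (λ ¬b → all-blocked (t , t∈A , ¬b))
      ...   | S , lt with t ∈? S
      ...     | yes t∈S = S , ℕ.<⇒≤pred (subst (capacity S κ <_) (ℕ.+-comm _ 1) lt) , λ _ → t∈S
      ...     | no _    = contradiction (subst (capacity S κ <_) (ℕ.+-identityʳ _) lt) (ℕ.≤⇒≯ (h′ S))
      union = tight-⋃ active′ allowed′ κ h′ q (λ t → proj₁ (block t)) (λ t → proj₁ (proj₂ (block t)))
      U = proj₁ union
      tight-U = proj₁ (proj₂ union)
      A⊆U : A ⊆ U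
      A⊆U {t} t∈A = proj₂ (proj₂ union) t (proj₂ (proj₂ (block t)) t∈A)

-- From words to splittings

countFin-cong : ∀ c {f g : Fin c → Bool} → f ≗ g → countFin c f ≡ countFin c g
countFin-cong zero    e = refl
countFin-cong (suc c) {f} {g} e rewrite e zero | countFin-cong c (e ∘ suc) = refl

countFin-none : ∀ c {f : Fin c → Bool} → (∀ k → f k ≡ false) → countFin c f ≡ zero
countFin-none zero    e = refl
countFin-none (suc c) e rewrite e zero | countFin-none c (e ∘ suc) = refl

countF≡size : ∀ n (f : Fin n → Bool) → countF n f ≡ size f
countF≡size zero    f = refl
countF≡size (suc n) f = cong (𝟙 (f zero) +_) (countF≡size n (f ∘ suc))

≤?-suc : ∀ a b → ⌊ suc a ℕ.≤? suc b ⌋ ≡ ⌊ a ℕ.≤? b ⌋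
≤?-suc a b = ⌊⌋-⇔ (suc a ℕ.≤? suc b) (a ℕ.≤? b) ℕ.s≤s⁻¹ s≤s

≤?-zero : ∀ a → ⌊ suc a ℕ.≤? 0 ⌋ ≡ false
≤?-zero a with suc a ℕ.≤? 0
... | no _ = refl

module _ {q : ℕ} (o : Fin q) where
  open Splitting

  -- Cuts are placed exactly where neighbouring letters differ. The thief `o` serves the empty
  -- necklace, whose single interval still needs an owner.
  splitting : ∀ {n} (w : Vec (Fin q) n) → Σ (Splitting n q) λ s → c s ≡ changes w × (∀ i → thief s i ≡ lookup w i)
  splitting []          = record { c = 0 ; cut = λ () ; cut-pos = λ () ; cut-inc = λ () ; assign = λ _ → o } , refl , λ ()
  splitting (a ∷ [])    = record { c = 0 ; cut = λ () ; cut-pos = λ () ; cut-inc = λ () ; assign = λ _ → a } ,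
                          refl , λ { zero → refl }
  splitting {suc n@(suc _)} (a ∷ w@(b ∷ _)) with splitting w
  ... | s , c≡ , thief≡ = extend
    where
    interval-zero : interval s zero ≡ zero
    interval-zero = countFin-none (c s) λ k → none k (proj₁ (cut-pos s k))
      where
      none : ∀ k → 0 < cut s k → ⌊ cut s k ℕ.≤? 0 ⌋ ≡ false
      none k 0<  with cut s k
      none k (s≤s _) | suc x = ≤?-zero x
    assign-zero : assign s zero ≡ b
    assign-zero = trans (cong (assign s) (sym interval-zero)) (thief≡ zero)
    extend : Σ (Splitting (suc n) q) λ s → c s ≡ jump a b + changes w × (∀ i → thief s i ≡ lookup (a ∷ w) i)
    extend with a ≟ b
    ... | yes a≡b = s′ , c≡ , λ
      { zero    → trans (cong (assign s) (countFin-none (c s) λ k → ≤?-zero (cut s k))) (trans assign-zero (sym a≡b))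
      ; (suc i) → trans (cong (assign s) (countFin-cong (c s) λ k → ≤?-suc (cut s k) (toℕ i))) (thief≡ i) }
      where
      s′ : Splitting (suc n) q
      s′ = record
        { c = c s ; cut = suc ∘ cut s
        ; cut-pos = λ k → s≤s z≤n , s≤s (proj₂ (cut-pos s k))
        ; cut-inc = λ k l k<l → s≤s (cut-inc s k l k<l)
        ; assign = assign s }
    ... | no _ = s′ , cong suc c≡ , λ
      { zero    → cong assign′ (countFin-none (suc (c s)) {f = λ k → ⌊ cut′ k ℕ.≤? 0 ⌋} λ { zero → refl ; (suc k) → ≤?-zero (cut s k) })
      ; (suc i) → trans (cong assign′ (interval-suc i)) (thief≡ i) }
      where
      cut′ : Fin (suc (c s)) → ℕ
      cut′ zero    = 1
      cut′ (suc k) = suc (cut s k)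
      assign′ : Fin (suc (suc (c s))) → Fin q
      assign′ zero    = a
      assign′ (suc k) = assign s k
      s′ : Splitting (suc n) q
      s′ = record
        { c = suc (c s) ; cut = cut′
        ; cut-pos = λ { zero → s≤s z≤n , s≤s (s≤s z≤n) ; (suc k) → s≤s z≤n , s≤s (proj₂ (cut-pos s k)) }
        ; cut-inc = λ { zero (suc l) _ → s≤s (proj₁ (cut-pos s l)) ; (suc k) (suc l) k<l → s≤s (cut-inc s k l (ℕ.s≤s⁻¹ k<l)) }
        ; assign = assign′ }
      interval-suc : ∀ i → interval s′ (suc i) ≡ suc (interval s i)
      interval-suc i = cong suc (countFin-cong (c s) λ k → ≤?-suc (cut s k) (toℕ i))

-- Subsequences and copies of beads

jump-triangle : ∀ {q} (a d e : Fin q) → jump a e ≤ jump a d + jump d e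
jump-triangle a d e with a ≟ d
... | yes refl = ℕ.≤-refl
... | no _     = ℕ.≤-trans (jump≤1 a e) (ℕ.m≤m+n 1 _)

changes-drop : ∀ {q n} (a d : Fin q) (x : Vec (Fin q) n) → changes (a ∷ x) ≤ changes (a ∷ d ∷ x)
changes-drop a d []      = z≤n
changes-drop a d (e ∷ x) = ℕ.≤-trans (ℕ.+-monoˡ-≤ (changes (e ∷ x)) (jump-triangle a d e))
                                     (ℕ.≤-reflexive (ℕ.+-assoc (jump a d) (jump d e) (changes (e ∷ x))))

infix 4 _⊑_
data _⊑_ {A : Set} : ∀ {k n} → Vec A k → Vec A n → Set where
  []   : [] ⊑ []
  skip : ∀ {k n a} {y : Vec A k} {x : Vec A n} → y ⊑ x → y ⊑ a ∷ x
  keep : ∀ {k n a} {y : Vec A k} {x : Vec A n} → y ⊑ x → a ∷ y ⊑ a ∷ x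

changes-∷-⊑ : ∀ {q k n} (a : Fin q) {y : Vec (Fin q) k} {x : Vec (Fin q) n} → y ⊑ x → changes (a ∷ y) ≤ changes (a ∷ x)
changes-∷-⊑ a []                        = z≤n
changes-∷-⊑ a (skip {a = d} {x = x} s)  = ℕ.≤-trans (changes-∷-⊑ a s) (changes-drop a d x)
changes-∷-⊑ a (keep {a = b} s)          = ℕ.+-monoʳ-≤ (jump a b) (changes-∷-⊑ b s)

changes-⊑ : ∀ {q k n} {y : Vec (Fin q) k} {x : Vec (Fin q) n} → y ⊑ x → changes y ≤ changes x
changes-⊑ []                      = z≤n
changes-⊑ (skip {a = d} {x = x} s) = ℕ.≤-trans (changes-⊑ s) (changes-tail d x)
changes-⊑ (keep {a = b} s)         = changes-∷-⊑ b s

support : ∀ {q k} → Vec (Fin q) k → Subset q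
support []      = ⊥
support (u ∷ b) = ⁅ u ⁆ ∪ support b

skip-all : ∀ {A : Set} {k n j} {y : Vec A k} {x : Vec A n} (b : Vec A j) → y ⊑ x → y ⊑ b Vec.++ x
skip-all []      s = s
skip-all (_ ∷ b) s = skip (skip-all b s)

support-⊑ : ∀ {q k n j t} {y : Vec (Fin q) k} {x : Vec (Fin q) n} (b : Vec (Fin q) j) → t ∈ support b → y ⊑ x → t ∷ y ⊑ b Vec.++ x
support-⊑ []      t∈ s = contradiction t∈ ∉⊥
support-⊑ {t = t} (u ∷ b) t∈ s with x∈p∪q⁻ ⁅ u ⁆ (support b) t∈
... | inj₂ t∈b = skip (support-⊑ b t∈b s)
... | inj₁ t∈u with x∈⁅y⁆⇒x≡y u t∈u
...   | refl = keep (skip-all b s)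

-- Each chosen letter occurs in its own block and the blocks are in order; with `changes-⊑` this is
-- why rounding costs no cut.
choice-⊑ : ∀ {q n K} (y : Fin n → Fin q) (xss : Vec (Vec (Fin q) K) n) → (∀ i → y i ∈ support (lookup xss i)) →
           tabulate y ⊑ concat xss
choice-⊑ y []         y∈ = []
choice-⊑ y (xs ∷ xss) y∈ = support-⊑ xs (y∈ zero) (choice-⊑ (y ∘ suc) xss (y∈ ∘ suc))

capacity-+ : ∀ {q} (S : Subset q) f g → capacity S (λ t → f t + g t) ≡ capacity S f + capacity S g
capacity-+ S f g = trans (sum-cong-≗ λ t → ℕ.*-distribˡ-+ (𝟙 ⌊ t ∈? S ⌋) (f t) (g t))
                         (∑-distrib-+ (λ t → 𝟙 ⌊ t ∈? S ⌋ * f t) (λ t → 𝟙 ⌊ t ∈? S ⌋ * g t))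

share-++ : ∀ {m q k n} (c : Vec (Fin m) k) (d : Vec (Fin m) n) (x : Vec (Fin q) k) (y : Vec (Fin q) n) j t →
           share (c Vec.++ d) (x Vec.++ y) j t ≡ share c x j t + share d y j t
share-++ []      d []      y j t = refl
share-++ (a ∷ c) d (b ∷ x) y j t = trans (cong (𝟙 (⌊ a ≟ j ⌋ ∧ ⌊ b ≟ t ⌋) +_) (share-++ c d x y j t))
                                         (sym (ℕ.+-assoc (𝟙 (⌊ a ≟ j ⌋ ∧ ⌊ b ≟ t ⌋)) (share c x j t) (share d y j t)))

beads-++ : ∀ {m k n} (c : Vec (Fin m) k) (d : Vec (Fin m) n) j → beads (c Vec.++ d) j ≡ beads c j + beads d j
beads-++ []      d j = refl
beads-++ (a ∷ c) d j = trans (cong (𝟙 ⌊ a ≟ j ⌋ +_) (beads-++ c d j)) (sym (ℕ.+-assoc (𝟙 ⌊ a ≟ j ⌋) (beads c j) (beads d j)))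

beads-replicate : ∀ {m} K (c j : Fin m) → beads (replicate K c) j ≡ 𝟙 ⌊ c ≟ j ⌋ * K
beads-replicate zero    c j = sym (ℕ.*-zeroʳ (𝟙 ⌊ c ≟ j ⌋))
beads-replicate (suc K) c j = trans (cong (𝟙 ⌊ c ≟ j ⌋ +_) (beads-replicate K c j)) (sym (ℕ.*-suc (𝟙 ⌊ c ≟ j ⌋) K))

module _ {m : ℕ} (K : ℕ) where

  enlarge : ∀ {n} → (Fin n → Fin m) → Vec (Fin m) (n * K)
  enlarge col = concat (tabulate λ i → replicate K (col i))

  beads-enlarge : ∀ {n} (col : Fin n → Fin m) j → beads (enlarge col) j ≡ size (λ i → ⌊ col i ≟ j ⌋) * K
  beads-enlarge {zero}  col j = refl
  beads-enlarge {suc n} col j = begin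
    beads (replicate K (col zero) Vec.++ enlarge (col ∘ suc)) j
      ≡⟨ beads-++ (replicate K (col zero)) (enlarge (col ∘ suc)) j ⟩
    beads (replicate K (col zero)) j + beads (enlarge (col ∘ suc)) j
      ≡⟨ cong₂ _+_ (beads-replicate K (col zero) j) (beads-enlarge (col ∘ suc) j) ⟩
    𝟙 ⌊ col zero ≟ j ⌋ * K + size (λ i → ⌊ col (suc i) ≟ j ⌋) * K
      ≡⟨ ℕ.*-distribʳ-+ K (𝟙 ⌊ col zero ≟ j ⌋) _ ⟨
    size (λ i → ⌊ col i ≟ j ⌋) * K ∎
    where open ≡-Reasoning

  module _ {q : ℕ} (S : Subset q) (j : Fin m) where

    supported-share : ∀ {k} (b : Vec (Fin q) k) → support b ⊆ S → k ≤ capacity S (share (replicate k j) b j)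
    supported-share []      _   = z≤n
    supported-share {suc k} (u ∷ b) b⊆S = begin
      1 + k
        ≤⟨ ℕ.+-mono-≤ one (supported-share b (λ t∈ → b⊆S (q⊆p∪q ⁅ u ⁆ (support b) t∈))) ⟩
      capacity S (λ t → 𝟙 (⌊ j ≟ j ⌋ ∧ ⌊ u ≟ t ⌋)) + capacity S (share (replicate k j) b j)
        ≡⟨ capacity-+ S (λ t → 𝟙 (⌊ j ≟ j ⌋ ∧ ⌊ u ≟ t ⌋)) (share (replicate k j) b j) ⟨
      capacity S (share (replicate (suc k) j) (u ∷ b) j) ∎
      where
      open ℕ.≤-Reasoning
      one : 1 ≤ capacity S (λ t → 𝟙 (⌊ j ≟ j ⌋ ∧ ⌊ u ≟ t ⌋))
      one = begin
        1
          ≡⟨ cong₂ _*_ (cong 𝟙 (⌊⌋-intro (u ∈? S) (b⊆S (p⊆p∪q (support b) (x∈⁅x⁆ u)))))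
               (cong₂ (λ b b′ → 𝟙 (b ∧ b′)) (⌊⌋-intro (j ≟ j) refl) (⌊⌋-intro (u ≟ u) refl)) ⟨
        𝟙 ⌊ u ∈? S ⌋ * 𝟙 (⌊ j ≟ j ⌋ ∧ ⌊ u ≟ u ⌋)
          ≤⟨ ≤-sum (λ t → 𝟙 ⌊ t ∈? S ⌋ * 𝟙 (⌊ j ≟ j ⌋ ∧ ⌊ u ≟ t ⌋)) u ⟩
        capacity S (λ t → 𝟙 (⌊ j ≟ j ⌋ ∧ ⌊ u ≟ t ⌋)) ∎

    -- A bead whose copies belong only to thieves in S adds all K copies to the shares of S.
    demand-share : ∀ {n} (col : Fin n → Fin m) (xss : Vec (Vec (Fin q) K) n) →
      demand (λ i → ⌊ col i ≟ j ⌋) (λ i → support (lookup xss i)) S * K ≤ capacity S (share (enlarge col) (concat xss) j)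
    demand-share {zero}  col []         = z≤n
    demand-share {suc n} col (xs ∷ xss) = begin
      (𝟙 (⌊ col zero ≟ j ⌋ ∧ ⌊ support xs ⊆? S ⌋) + rest) * K
        ≡⟨ ℕ.*-distribʳ-+ K (𝟙 (⌊ col zero ≟ j ⌋ ∧ ⌊ support xs ⊆? S ⌋)) rest ⟩
      𝟙 (⌊ col zero ≟ j ⌋ ∧ ⌊ support xs ⊆? S ⌋) * K + rest * K
        ≤⟨ ℕ.+-mono-≤ first (demand-share (col ∘ suc) xss) ⟩
      capacity S (share (replicate K (col zero)) xs j) + capacity S (share (enlarge (col ∘ suc)) (concat xss) j)
        ≡⟨ capacity-+ S (share (replicate K (col zero)) xs j) (share (enlarge (col ∘ suc)) (concat xss) j) ⟨
      capacity S (λ t → share (replicate K (col zero)) xs j t + share (enlarge (col ∘ suc)) (concat xss) j t)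
        ≡⟨ sum-cong-≗ (λ t → cong (𝟙 ⌊ t ∈? S ⌋ *_) (share-++ (replicate K (col zero)) (enlarge (col ∘ suc)) xs (concat xss) j t)) ⟨
      capacity S (share (enlarge col) (concat (xs ∷ xss)) j) ∎
      where
      open ℕ.≤-Reasoning
      rest = demand (λ i → ⌊ col (suc i) ≟ j ⌋) (λ i → support (lookup xss i)) S
      first : 𝟙 (⌊ col zero ≟ j ⌋ ∧ ⌊ support xs ⊆? S ⌋) * K ≤ capacity S (share (replicate K (col zero)) xs j)
      first with col zero ≟ j | support xs ⊆? S
      ... | no _     | _      = z≤n
      ... | yes _    | no _   = z≤n
      ... | yes refl | yes ⊆S = ℕ.≤-trans (ℕ.≤-reflexive (ℕ.*-identityˡ K)) (supported-share xs ⊆S)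

size-∈? : ∀ {q} (S : Subset q) → size (λ t → ⌊ t ∈? S ⌋) ≡ ∣ S ∣
size-∈? []            = refl
size-∈? (b ∷ S) = trans (cong (𝟙 ⌊ zero ∈? b ∷ S ⌋ +_) (trans tail (size-∈? S))) (head b)
  where
  tail : size (λ t → ⌊ suc t ∈? b ∷ S ⌋) ≡ size (λ t → ⌊ t ∈? S ⌋)
  tail = sum-cong-≗ λ t → cong 𝟙 (⌊⌋-⇔ (suc t ∈? b ∷ S) (t ∈? S) drop-there there)
  head : ∀ b → 𝟙 ⌊ zero ∈? b ∷ S ⌋ + ∣ S ∣ ≡ ∣ b ∷ S ∣
  head inside  = refl
  head outside = refl

sum-load : ∀ {n q} (b : Fin n → Bool) (y : Fin n → Fin q) → sum (λ t → size (λ i → b i ∧ ⌊ y i ≟ t ⌋)) ≡ size b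
sum-load b y = trans (∑-comm (λ t i → 𝟙 (b i ∧ ⌊ y i ≟ t ⌋))) (sum-cong-≗ λ i → sum-∧-≟ (b i) (y i))

⌈/⌉≡suc : ∀ a q .{{_ : NonZero q}} → a % q ≢ 0 → ⌈ a / q ⌉ ≡ suc (a / q)
⌈/⌉≡suc a q@(suc q-1) r≢0 with a % q in eq
... | zero  = contradiction refl r≢0
... | suc r = begin
  (a + q-1) / q                          ≡⟨ cong (λ z → (z + q-1) / q) (m≡m%n+[m/n]*n a q) ⟩
  (a % q + a / q * q + q-1) / q          ≡⟨ cong (λ z → (z + a / q * q + q-1) / q) eq ⟩
  (suc r + a / q * q + q-1) / q          ≡⟨ cong (_/ q) (ring r (a / q) q-1) ⟩
  (r + suc (a / q) * q) / q              ≡⟨ +-distrib-/-∣ʳ r (ℕ.n∣m*n (suc (a / q))) ⟩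
  r / q + suc (a / q) * q / q            ≡⟨ cong₂ _+_ (m<n⇒m/n≡0 (ℕ.<-trans (ℕ.n<1+n r) (subst (_< q) eq (m%n<n a q))))
                                                       (m*n/n≡m (suc (a / q)) q) ⟩
  suc (a / q)                            ∎
  where
  open ≡-Reasoning
  ring : ∀ r f k → (1 + r) + f * (1 + k) + k ≡ r + (1 + f) * (1 + k)
  ring = solve-∀

-- Multiplied through by q, the failure of Hall's condition would read q (X + 1) ≤ k r; together with k + r ≤ X + q this
-- is where the hypothesis on the remainders enters.
hall-arithmetic : ∀ {q B k f r X} → 0 < q → q * B ≤ k * (r + f * q) → k ≤ q → k + r ≤ X + q →
                  r ≡ 0 ⊎ r ≡ 1 ⊎ r ≡ q ∸ 1 → B ≤ k * f + X
hall-arithmetic {q} {B} {k} {f} {r} {X} 0<q qB≤ k≤q k+r≤ cases = ℕ.≮⇒≥ λ lt → absurd (core lt) cases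
  where
  open ℕ.≤-Reasoning
  core : k * f + X < B → q * suc X ≤ k * r
  core lt = ℕ.+-cancelˡ-≤ (k * f * q) _ _ (begin
    k * f * q + q * suc X     ≡⟨ ring₁ k f q X ⟩
    q * suc (k * f + X)       ≤⟨ ℕ.*-monoʳ-≤ q lt ⟩
    q * B                     ≤⟨ qB≤ ⟩
    k * (r + f * q)           ≡⟨ ring₂ k r f q ⟩
    k * f * q + k * r         ∎)
    where
    ring₁ : ∀ k f q X → k * f * q + q * (1 + X) ≡ q * (1 + (k * f + X))
    ring₁ = solve-∀
    ring₂ : ∀ k r f q → k * (r + f * q) ≡ k * f * q + k * r
    ring₂ = solve-∀
  absurd : q * suc X ≤ k * r → r ≡ 0 ⊎ r ≡ 1 ⊎ r ≡ q ∸ 1 → Empty.⊥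
  absurd le (inj₁ refl) = contradiction (begin
    1          ≤⟨ ℕ.*-mono-≤ 0<q (s≤s (z≤n {X})) ⟩
    q * suc X  ≤⟨ le ⟩
    k * 0      ≡⟨ ℕ.*-zeroʳ k ⟩
    0          ∎) λ ()
  -- Here q (X + 1) ≤ k ≤ q forces X = 0 and k = q: all thieves are in S and yet none of them has an
  -- extra bead.
  absurd le (inj₂ (inj₁ refl)) = contradiction (begin
    suc q      ≤⟨ s≤s q≤k ⟩
    1 + k      ≡⟨ ℕ.+-comm 1 k ⟩
    k + 1      ≤⟨ k+r≤ ⟩
    X + q      ≡⟨ cong (_+ q) X≡0 ⟩
    q          ∎) ℕ.1+n≰n
    where
    q*sX≤k : q * suc X ≤ k
    q*sX≤k = ℕ.≤-trans le (ℕ.≤-reflexive (ℕ.*-identityʳ k))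
    q≤k : q ≤ k
    q≤k = ℕ.≤-trans (ℕ.m≤m*n q (suc X)) q*sX≤k
    X≡0 : X ≡ 0
    X≡0 = ℕ.n≤0⇒n≡0 (ℕ.s≤s⁻¹ (ℕ.*-cancelˡ-≤ q {{ℕ.>-nonZero 0<q}}
      (ℕ.≤-trans q*sX≤k (ℕ.≤-trans k≤q (ℕ.≤-reflexive (sym (ℕ.*-identityʳ q)))))))
  -- Only one thief goes without an extra bead, so k ≤ X + 1; then q k ≤ k (q - 1), which leaves k =
  -- 0.
  absurd le (inj₂ (inj₂ refl)) = contradiction (begin
    1                ≤⟨ ℕ.*-mono-≤ 0<q (s≤s (z≤n {X})) ⟩
    q * suc X        ≤⟨ le ⟩
    k * (q ∸ 1)      ≡⟨ cong (_* (q ∸ 1)) (ℕ.n≤0⇒n≡0 k≤0) ⟩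
    0                ∎) λ ()
    where
    q≡ : suc (q ∸ 1) ≡ q
    q≡ = ℕ.suc-pred q {{ℕ.>-nonZero 0<q}}
    k≤sX : k ≤ suc X
    k≤sX = ℕ.+-cancelʳ-≤ (q ∸ 1) _ _ (begin
      k + (q ∸ 1)         ≤⟨ k+r≤ ⟩
      X + q               ≡⟨ cong (X +_) q≡ ⟨
      X + suc (q ∸ 1)     ≡⟨ ℕ.+-suc X (q ∸ 1) ⟩
      suc X + (q ∸ 1)     ∎)
    k≤0 : k ≤ 0
    k≤0 = ℕ.+-cancelʳ-≤ (k * (q ∸ 1)) _ _ (begin
      k + k * (q ∸ 1)     ≡⟨ ℕ.*-suc k (q ∸ 1) ⟨
      k * suc (q ∸ 1)     ≡⟨ cong (k *_) q≡ ⟩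
      k * q               ≡⟨ ℕ.*-comm k q ⟩
      q * k               ≤⟨ ℕ.*-monoʳ-≤ q k≤sX ⟩
      q * suc X           ≤⟨ le ⟩
      k * (q ∸ 1)         ∎)

-- Rounding to the prescribed quotas

module Rounding (q : ℕ) .{{_ : NonZero q}} {n m : ℕ} (col : Fin n → Fin m)
  (remainders : ∀ j → (colourCount col j % q ≡ 0) ⊎ (colourCount col j % q ≡ 1) ⊎ (colourCount col j % q ≡ q ∸ 1))
  (A : Fin m → Subset q) (∣A∣ : ∀ j → colourCount col j % q ≢ 0 → ∣ A j ∣ ≡ colourCount col j % q) where

  a r f : Fin m → ℕ
  a j = colourCount col j
  r j = a j % q
  f j = a j / q

  -- For r j = 0 nothing ties the size of `A j` to the remainder, so the set is not consulted; the
  -- quotas of a colour then always add up to a j.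
  extra : Fin m → Fin q → ℕ
  extra j t with r j ℕ.≟ 0
  ... | yes _ = 0
  ... | no _  = 𝟙 ⌊ t ∈? A j ⌋

  quota : Fin m → Fin q → ℕ
  quota j t = f j + extra j t

  sum-extra : ∀ j → sum (extra j) ≡ r j
  sum-extra j with r j ℕ.≟ 0
  ... | yes r≡0 = trans (sum-zero q) (sym r≡0)
  ... | no r≢0  = trans (size-∈? (A j)) (∣A∣ j r≢0)

  extra≤1 : ∀ j t → extra j t ≤ 1
  extra≤1 j t with r j ℕ.≟ 0
  ... | yes _ = z≤n
  ... | no _  = 𝟙≤1 ⌊ t ∈? A j ⌋

  a≡ : ∀ j → a j ≡ r j + f j * q
  a≡ j = m≡m%n+[m/n]*n (a j) q

  sum-quota : ∀ j → sum (quota j) ≡ a j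
  sum-quota j = begin
    sum (quota j)                         ≡⟨ ∑-distrib-+ (λ _ → f j) (extra j) ⟩
    sum {q} (λ _ → f j) + sum (extra j)   ≡⟨ cong₂ _+_ (sum-const q (f j)) (sum-extra j) ⟩
    q * f j + r j                         ≡⟨ cong (_+ r j) (ℕ.*-comm q (f j)) ⟩
    f j * q + r j                         ≡⟨ ℕ.+-comm (f j * q) (r j) ⟩
    r j + f j * q                         ≡⟨ a≡ j ⟨
    a j                                   ∎
    where open ≡-Reasoning

  has : Fin m → Fin n → Bool
  has j i = ⌊ col i ≟ j ⌋

  load : (Fin n → Fin q) → Fin m → Fin q → ℕ
  load y j t = size λ i → has j i ∧ ⌊ y i ≟ t ⌋

  quota-lucky : ∀ j → r j ≢ 0 → ∀ {t} → t ∈ A j → quota j t ≡ ⌈ a j / q ⌉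
  quota-lucky j r≢0 {t} t∈ with r j ℕ.≟ 0
  ... | yes r≡0 = contradiction r≡0 r≢0
  ... | no _    = trans (cong (λ b → f j + 𝟙 b) (⌊⌋-intro (t ∈? A j) t∈)) (trans (ℕ.+-comm (f j) 1) (sym (⌈/⌉≡suc (a j) q r≢0)))

  quota-unlucky : ∀ j {t} → (r j ≢ 0 → t ∉ A j) → quota j t ≡ f j
  quota-unlucky j {t} t∉ with r j ℕ.≟ 0
  ... | yes _  = ℕ.+-identityʳ (f j)
  ... | no r≢0 with t ∈? A j
  ...   | yes t∈ = contradiction t∈ (t∉ r≢0)
  ...   | no _   = ℕ.+-identityʳ (f j)

  -- A bead has one colour, so colours are rounded independently. Loads bounded by quotas with the
  -- same total must equal them.
  glue : (block : Fin n → Subset q) →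
    (∀ j → ∃ λ (c : Fin n → Fin q) → (∀ i → has j i ≡ true → c i ∈ block i) × (∀ t → load c j t ≤ quota j t)) →
    ∃ λ (y : Fin n → Fin q) → (∀ i → y i ∈ block i) × (∀ j t → load y j t ≡ quota j t)
  glue block choices = y , (λ i → proj₁ (proj₂ (choices (col i))) i (⌊⌋-intro (col i ≟ col i) refl)) , load≡
    where
    choice : Fin m → Fin n → Fin q
    choice j = proj₁ (choices j)
    y : Fin n → Fin q
    y i = choice (col i) i
    same : ∀ j t i → has j i ∧ ⌊ y i ≟ t ⌋ ≡ has j i ∧ ⌊ choice j i ≟ t ⌋
    same j t i with col i ≟ j
    ... | yes refl = refl
    ... | no _     = refl
    load≤ : ∀ j t → load y j t ≤ quota j t
    load≤ j t = ℕ.≤-trans (ℕ.≤-reflexive (sum-cong-≗ λ i → cong 𝟙 (same j t i))) (proj₂ (proj₂ (choices j)) t)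
    load≡ : ∀ j t → load y j t ≡ quota j t
    load≡ j = sum≡⇒≗ (load≤ j) (ℕ.≤-reflexive (begin
      sum (quota j)  ≡⟨ sum-quota j ⟩
      a j            ≡⟨ countF≡size n (has j) ⟩
      size (has j)   ≡⟨ sum-load (has j) y ⟨
      sum (load y j) ∎))
      where open ≡-Reasoning

  module _ {E : ℕ} (xss : Vec (Vec (Fin q) (suc (q * E))) n)
    (almost : ∀ j t → q * share (enlarge (suc (q * E)) col) (concat xss) j t ≤ beads (enlarge (suc (q * E)) col) j + E) where

    private
      K : ℕ
      K = suc (q * E)

    block : Fin n → Subset q
    block i = support (lookup xss i)

    module _ (j : Fin m) (S : Subset q) where

      private
        B k X : ℕ
        B = demand (has j) block S
        k = size λ t → ⌊ t ∈? S ⌋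
        X = capacity S (extra j)

      -- A violation would be by a whole unit, worth K on the copies, whereas the accumulated error
      -- k E ≤ q E is smaller; this fixes K = q E + 1.
      scaled-demand : q * B ≤ k * a j
      scaled-demand = ℕ.≮⇒≥ λ lt → ℕ.<⇒≱ (slack lt) qBK≤
        where
        open ℕ.≤-Reasoning
        qBK≤ : q * B * K ≤ k * (a j * K + E)
        qBK≤ = begin
          q * B * K
            ≡⟨ ℕ.*-assoc q B K ⟩
          q * (B * K)
            ≤⟨ ℕ.*-monoʳ-≤ q (demand-share K S j col xss) ⟩
          q * capacity S (share (enlarge K col) (concat xss) j)
            ≡⟨ *-distribˡ-sum q (λ t → 𝟙 ⌊ t ∈? S ⌋ * share (enlarge K col) (concat xss) j t) ⟩
          sum (λ t → q * (𝟙 ⌊ t ∈? S ⌋ * share (enlarge K col) (concat xss) j t))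
            ≤⟨ sum-mono (λ t → begin
                 q * (𝟙 ⌊ t ∈? S ⌋ * share (enlarge K col) (concat xss) j t)
                   ≡⟨ ring q (𝟙 ⌊ t ∈? S ⌋) (share (enlarge K col) (concat xss) j t) ⟩
                 𝟙 ⌊ t ∈? S ⌋ * (q * share (enlarge K col) (concat xss) j t)
                   ≤⟨ ℕ.*-monoʳ-≤ (𝟙 ⌊ t ∈? S ⌋) (almost j t) ⟩
                 𝟙 ⌊ t ∈? S ⌋ * (beads (enlarge K col) j + E)
                   ≡⟨ cong (λ z → 𝟙 ⌊ t ∈? S ⌋ * (z + E))
                        (trans (beads-enlarge K col j) (cong (_* K) (sym (countF≡size n (has j))))) ⟩
                 𝟙 ⌊ t ∈? S ⌋ * (a j * K + E) ∎) ⟩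
          sum (λ t → 𝟙 ⌊ t ∈? S ⌋ * (a j * K + E))
            ≡⟨ *-distribʳ-sum (a j * K + E) (λ t → 𝟙 ⌊ t ∈? S ⌋) ⟨
          k * (a j * K + E) ∎
          where
          ring : ∀ q b s → q * (b * s) ≡ b * (q * s)
          ring = solve-∀
        slack : k * a j < q * B → k * (a j * K + E) < q * B * K
        slack lt = begin-strict
          k * (a j * K + E)         ≡⟨ ring k (a j) K E ⟩
          k * E + k * a j * K       ≤⟨ ℕ.+-monoˡ-≤ (k * a j * K) (ℕ.*-monoˡ-≤ E (size≤ λ t → ⌊ t ∈? S ⌋)) ⟩
          q * E + k * a j * K       <⟨ ℕ.n<1+n _ ⟩
          suc (k * a j) * K         ≤⟨ ℕ.*-monoˡ-≤ K lt ⟩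
          q * B * K                 ∎
          where
          ring : ∀ k a K E → k * (a * K + E) ≡ k * E + k * a * K
          ring = solve-∀

      feasible : B ≤ capacity S (quota j)
      feasible = begin
        B
          ≤⟨ hall-arithmetic {q} {B} {k} {f j} {r j} {X} (ℕ.n≢0⇒n>0 (ℕ.≢-nonZero⁻¹ q)) (subst (λ z → q * B ≤ k * z) (a≡ j) scaled-demand)
               (size≤ λ t → ⌊ t ∈? S ⌋) k+r≤ (remainders j) ⟩
        k * f j + X
          ≡⟨ cong (_+ X) (*-distribʳ-sum (f j) (λ t → 𝟙 ⌊ t ∈? S ⌋)) ⟩
        capacity S (λ _ → f j) + X
          ≡⟨ capacity-+ S (λ _ → f j) (extra j) ⟨
        capacity S (quota j) ∎
        where
        open ℕ.≤-Reasoning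
        pointwise : ∀ {b e} → b ≤ 1 → e ≤ 1 → b + e ≤ b * e + 1
        pointwise {zero}        _ e≤1 = e≤1
        pointwise {suc zero}    _ _   = ℕ.≤-reflexive (trans (ℕ.+-comm 1 _) (cong (_+ 1) (sym (ℕ.+-identityʳ _))))
        pointwise {suc (suc _)} (s≤s ()) _
        -- Inclusion and exclusion for S and the set of thieves with an extra bead.
        k+r≤ : k + r j ≤ X + q
        k+r≤ = begin
          k + r j                                            ≡⟨ cong (k +_) (sum-extra j) ⟨
          k + sum (extra j)                                  ≤⟨ sum-submodular {g = extra j} {g′ = λ _ → 1}
                                                                   (λ t → pointwise (𝟙≤1 ⌊ t ∈? S ⌋) (extra≤1 j t)) ⟩
          X + sum {q} (λ _ → 1)                              ≡⟨ cong (X +_) (trans (sum-const q 1) (ℕ.*-identityʳ q)) ⟩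
          X + q                                              ∎

    rounding : ∃ λ (y : Fin n → Fin q) → changes (tabulate y) ≤ changes (concat xss) × (∀ j t → load y j t ≡ quota j t)
    rounding =
      let y , y∈ , load≡ = glue block λ j → hall (0 mod q) (has j) block (quota j) (feasible j)
      in  y , changes-⊑ (choice-⊑ y xss y∈) , load≡

  rounded : ∃ λ (y : Fin n → Fin q) → changes (tabulate y) ≤ (q ∸ 1) * m × (∀ j t → load y j t ≡ quota j t)
  rounded =
    -- E does not depend on the length, so the number of copies may be chosen in terms of E although
    -- it determines the length.
    let E , splittings = almostFair q m
        K = suc (q * E)
        x , x-cuts , almost = splittings (enlarge K col)
        xss , x≡ = Vec.group n K x
        y , y⊑ , load≡ = rounding xss (subst (λ x → ∀ j t → q * share (enlarge K col) x j t ≤ beads (enlarge K col) j + E) x≡ almost)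
    in  y , ℕ.≤-trans y⊑ (subst (λ x → changes x ≤ (q ∸ 1) * m) x≡ x-cuts) , load≡

  received≡ : ∀ {y} → (∀ j t → load y j t ≡ quota j t) → (s : Splitting n q) →
              (∀ i → Splitting.thief s i ≡ lookup (tabulate y) i) → ∀ t j → received col s t j ≡ quota j t
  received≡ {y} load≡ s thief≡ t j = begin
    received col s t j
      ≡⟨ countF≡size n (λ i → has j i ∧ ⌊ Splitting.thief s i ≟ t ⌋) ⟩
    size (λ i → has j i ∧ ⌊ Splitting.thief s i ≟ t ⌋)
      ≡⟨ sum-cong-≗ (λ i → cong (λ u → 𝟙 (has j i ∧ ⌊ u ≟ t ⌋)) (trans (thief≡ i) (Vec.lookup∘tabulate y i))) ⟩
    load y j t
      ≡⟨ load≡ j t ⟩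
    quota j t ∎
    where open ≡-Reasoning

  fair : (s : Splitting n q) → (∀ t j → received col s t j ≡ quota j t) → Fair col s
  fair s received≡ t j with r j ℕ.≟ 0 | t ∈? A j
  ... | yes r≡0 | _      = inj₁ (trans (received≡ t j) (quota-unlucky j λ r≢0 → contradiction r≡0 r≢0))
  ... | no r≢0  | yes t∈ = inj₂ (trans (received≡ t j) (quota-lucky j r≢0 t∈))
  ... | no _    | no t∉  = inj₁ (trans (received≡ t j) (quota-unlucky j λ _ → t∉))

theorem2 : (q : ℕ) .{{_ : NonZero q}} (n m : ℕ) (col : Fin n → Fin m) →
    (∀ j → (colourCount col j % q ≡ 0) ⊎ (colourCount col j % q ≡ 1) ⊎ (colourCount col j % q ≡ q ∸ 1)) →
    (A : Fin m → Subset q) →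
    (∀ j → colourCount col j % q ≢ 0 → ∣ A j ∣ ≡ colourCount col j % q) →
    Σ (Splitting n q) λ s →
    Fair col s × Splitting.c s ≤ (q ∸ 1) * m ×
    (∀ j → colourCount col j % q ≢ 0 → ∀ t →
    (t ∈ A j → received col s t j ≡ ⌈ colourCount col j / q ⌉) ×
    (t ∉ A j → received col s t j ≡ colourCount col j / q))
theorem2 q n m col remainders A ∣A∣ =
  let y , cuts , load≡ = rounded
      s , c≡ , thief≡ = splitting (0 mod q) (tabulate y)
      shares = received≡ load≡ s thief≡
  in  s , fair s shares , subst (_≤ (q ∸ 1) * m) (sym c≡) cuts ,
      λ j r≢0 t → (λ t∈ → trans (shares t j) (quota-lucky j r≢0 t∈)) ,
                  (λ t∉ → trans (shares t j) (quota-unlucky j λ _ → t∉))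
  where open Rounding q col remainders A ∣A∣
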